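{- Let $b\ge 4$ and $n\ge 1$ be integers, let $d$ be a positive integer with $d<b^{1/3}$, and let $c$ be an integer with $0\le c<d$ and $\gcd(c,d)=1$. Put $\alpha=\sqrt{b/d^3}$ and assume $\alpha\ge n^{3/2}+n$. Let $a$ be an integer with $\gcd(a,b)=1$ and $$0<a-b\cdot\frac cd\le \frac{\alpha}{n}-1 .$$ For each positive divisor $r$ of $n$ and each $j\in\{0,\dots,r-1\}$ put $$k(r,j)=\gcd\!\left(\tfrac nr a+jb,\ rb\right),\qquad m(r,j)=\gcd\!\left(\tfrac nr c+jd,\ rd\right),$$ $$a(r,j)=\frac{\frac nr a+jb}{k(r,j)},\quad b(r,j)=\frac{rb}{k(r,j)},\quad c(r,j)=\frac{\frac nr c+jd}{m(r,j)},\quad d(r,j)=\frac{rd}{m(r,j)}.$$ Then for every such pair $(r,j)$, the integer $a(r,j)$ is a Farey neighbour of $b(r,j)\cdot c(r,j)/d(r,j)$ (with respect to $b(r,j)$); hence $S[r,j]:=S\!\left(\tfrac nr a+jb,\ rb\right)=S(a(r,j),b(r,j))$ is positive. Moreover its expected value satisfies $$E[r,j]=\frac{m(r,j)^2}{n}\,E(a,b).$$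
   Context: For a positive integer $B$ and $A\in\mathbb Z$, the normalized Dedekind sum is $S(A,B)=12\sum_{k=1}^{B}((k/B))((Ak/B))$, where $((t))=t-\lfloor t\rfloor-1/2$ for $t\notin\mathbb Z$ and $((t))=0$ for $t\in\mathbb Z$; one has $S(Ad,Bd)=S(A,B)$ for positive integers $d$. Given a positive integer $B\ge 4$, a positive integer $D<B^{1/3}$ and an integer $C$ with $\gcd(C,D)=1$, the number $B\cdot C/D$ is called a Farey point with respect to $B$; an integer $A$ with $\gcd(A,B)=1$ is a Farey neighbour of $B\cdot C/D$ if $0\le A-B\cdot C/D\le \sqrt{B/D^3}-1$. For such $A$, with $Q=AD-BC>0$, the expected value of $S(A,B)$ is $E(A,B)=\frac{B}{DQ}$ (depending on the Farey point $B\cdot C/D$). In particular $E(a,b)=b/(dq)$ with $q=ad-bc$, and $E[r,j]=E(a(r,j),b(r,j))=\frac{b(r,j)}{d(r,j)\,q(r,j)}$ with $q(r,j)=a(r,j)d(r,j)-b(r,j)c(r,j)$. -}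

module Defs where

open import Data.Nat as ℕ using (ℕ; zero; suc)
open import Data.Integer as ℤ using (ℤ; +_; -[1+_]; +[1+_]; ∣_∣)
open import Data.Integer.DivMod using (_%ℕ_)
open import Data.Integer.GCD using (gcd)
open import Data.Rational as ℚ using (ℚ; 0ℚ; ½)
open import Data.List using (List; map; foldr; upTo)
open import Data.Product using (_×_)
open import Relation.Binary.PropositionalEquality using (_≡_)

-- Total integer division (floor division; returns 0 when the divisor is 0).
-- Only ever used below for exact divisions by positive divisors.
_divz_ : ℤ → ℤ → ℤ
x divz (+ zero)  = + 0
x divz +[1+ m ]  = x ℤ./ +[1+ m ]
x divz -[1+ m ]  = x ℤ./ -[1+ m ]

_÷z_ : ℤ → ℤ → ℚ
p ÷z (+ zero)  = 0ℚ
p ÷z +[1+ m ]  = p ℚ./ suc m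
p ÷z -[1+ m ]  = (ℤ.- p) ℚ./ suc m

-- Sawtooth function ((p/B)) for a positive integer B = suc m:
-- ((t)) = t - ⌊t⌋ - 1/2 if t ∉ ℤ, and 0 if t ∈ ℤ.
saw : ℤ → ℕ → ℚ
saw p zero    = 0ℚ
saw p (suc m) with p %ℕ (suc m)
... | zero    = 0ℚ
... | suc r   = ((+ suc r) ℚ./ suc m) ℚ.- ½

sumℚ : List ℚ → ℚ
sumℚ = foldr ℚ._+_ 0ℚ

-- Normalized Dedekind sum S(A,B) = 12 Σ_{k=1}^{B} ((k/B)) ((Ak/B)), for B > 0
-- (B is read through its absolute value; only positive B are used).
S : ℤ → ℤ → ℚ
S A B = (+ 12 ℚ./ 1) ℚ.* sumℚ (map (λ k → saw (+ k) N ℚ.* saw (A ℤ.* + k) N)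
                                    (map suc (upTo N)))
  where N = ∣ B ∣

qv : ℤ → ℤ → ℤ → ℤ → ℤ
qv A B C D = A ℤ.* D ℤ.- B ℤ.* C

E : ℤ → ℤ → ℤ → ℤ → ℚ
E A B C D = B ÷z (D ℤ.* qv A B C D)

-- A is a Farey neighbour of the Farey point B·C/D (w.r.t. B):
--   B ≥ 4, D a positive integer with D < B^{1/3} (i.e. D³ < B), gcd(C,D) = 1,
--   gcd(A,B) = 1, and 0 ≤ A - B·C/D ≤ √(B/D³) - 1.
-- The last condition, multiplied by D > 0, reads 0 ≤ Q and Q/D + 1 ≤ √(B/D³)
-- (Q = AD - BC); since Q/D + 1 > 0, the right inequality is equivalent to
-- (Q + D)² · D ≤ B.
IsFareyNeighbour : ℤ → ℤ → ℤ → ℤ → Set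
IsFareyNeighbour A B C D =
  (+ 4 ℤ.≤ B) × (+ 0 ℤ.< D) × (D ℤ.^ 3 ℤ.< B) × (gcd C D ≡ + 1) ×
  (gcd A B ≡ + 1) × (+ 0 ℤ.≤ qv A B C D) ×
  (((qv A B C D ℤ.+ D) ℤ.^ 2) ℤ.* D ℤ.≤ B)

{-# OPTIONS --safe #-}

-- For A coprime to N the number V(A,N) = N·S(A,N) is an integer. Dedekind reciprocity
-- A·V(A,B) + B·V(B,A) = A² + B² + 1 − 3AB comes from counting the lattice points of a rectangle
-- on both sides of its diagonal, together with Σ (Ak mod B)² = Σ k². The Euclidean algorithm
-- turns reciprocity into the bound V(C,D) ≥ −(D−1)(D−2), and into the three-term relation
--   S(A,B) = S(C,D) + S(R,Q) + (B² + D² + Q²)/(BDQ) − 3,   Q = AD − BC,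
-- for some R coprime to Q. For a Farey neighbour B/(DQ) ≥ (Q+D)²/Q, which outweighs both lower
-- bounds, so S(A,B) > 0.
-- As the matrix (n/r, j; 0, r) has determinant n, k(r,j) m(r,j) q(r,j) = n q, and k(r,j) divides n
-- because (a,b) is primitive; the Farey condition for (r,j) thus reduces to the inequality
-- n²(q + kd)²d ≤ kb for 1 ≤ k ≤ n.
module Submission where

open import Defs
open import Data.Nat as ℕ using (ℕ; zero; suc; NonZero)
import Data.Nat.DivMod as ℕ
import Data.Nat.GCD as ℕ
import Data.Nat.Properties as ℕ
open import Data.Nat.Divisibility as ℕ using (_∣_)
open import Data.Nat.Induction using (Acc; acc; <-wellFounded)
open import Data.Integer as ℤ using (ℤ; +_; -[1+_]; +[1+_]; _+_; _*_; -_; _-_; _%ℕ_; _/ℕ_)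
import Data.Integer.Properties as ℤ
open import Data.Integer.DivMod using (n%ℕd<d; a≡a%ℕn+[a/ℕn]*n; div-pos-is-/ℕ)
open import Data.Integer.Divisibility.Signed as ℤ using (divides; ∣⇒∣ᵤ; ∣ᵤ⇒∣)
open import Data.Integer.GCD using (gcd; gcd[i,j]∣i; gcd[i,j]∣j)
open import Data.Integer.Tactic.RingSolver using (solve-∀)
open import Data.Rational as ℚ using (ℚ; 0ℚ; toℚᵘ; fromℚᵘ)
import Data.Rational.Properties as ℚ
open import Data.Rational.Unnormalised as ℚᵘ using (mkℚᵘ; *≡*)
import Data.Rational.Unnormalised.Properties as ℚᵘ
open import Data.Fin using (Fin; toℕ; fromℕ<)
open import Data.Fin.Permutation using (permutation)
import Data.Fin.Properties as Fin
open import Data.List using (map; applyUpTo)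
open import Data.Product using (Σ-syntax; _×_; _,_; proj₁; proj₂)
open import Data.Sum using (_⊎_; inj₁; inj₂)
open import Algebra.Properties.AbelianGroup ℤ.+-0-abelianGroup using (∙-cancelʳ)
open import Algebra.Properties.Semiring.Sum ℤ.+-*-semiring
  using (sum; sum-cong-≗; ∑-distrib-+; ∑-comm; *-distribˡ-sum; sum-permute)
open import Function using (_∘_)
open import Relation.Binary.PropositionalEquality
  using (_≡_; _≢_; refl; sym; trans; cong; cong₂; subst; module ≡-Reasoning)
open import Relation.Nullary using (contradiction; yes; no)

-- Finite sums and division with remainder

-- The three-term relation does not say which R occurs, and it need not: the lower bound on V is
-- uniform in the numerator, so coprimality of R and Q is all that is carried along. The induction
-- runs Euclid's algorithm on C/D and applies the same quotient to A/B. This keeps Q fixed, and Q >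
-- 0 keeps the new modulus on the A side positive. The constant n^{3/2} + n has the following
-- origin. The expression kb - n²(q + kd)²d is a concave quadratic in k. At k = 1 it is nonnegative
-- by the assumption on a, so on 1 ≤ k ≤ n it is enough that the chord from k = 1 to k = n does not
-- descend. Its slope is b - n²(n-1)d³ - 2n²(q+d)d². With b = α²d³ and q + d at its largest value
-- dα/n, nonnegativity of the slope reads (α - n)² ≥ n³, and for α ≥ n this is α ≥ n^{3/2} + n.

∑ : ℕ → (ℕ → ℤ) → ℤ
∑ n f = sum {n} (f ∘ toℕ)

∑-cong : ∀ n {f g : ℕ → ℤ} → (∀ k → k ℕ.< n → f k ≡ g k) → ∑ n f ≡ ∑ n g
∑-cong n f≗g = sum-cong-≗ {n} (λ i → f≗g (toℕ i) (Fin.toℕ<n i))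

∑-+ : ∀ n (f g : ℕ → ℤ) → ∑ n (λ k → f k + g k) ≡ ∑ n f + ∑ n g
∑-+ n f g = ∑-distrib-+ {n} (f ∘ toℕ) (g ∘ toℕ)

∑-* : ∀ n c (f : ℕ → ℤ) → ∑ n (λ k → c * f k) ≡ c * ∑ n f
∑-* n c f = sym (*-distribˡ-sum {n} c (f ∘ toℕ))

∑-comb : ∀ n c d (f g : ℕ → ℤ) → ∑ n (λ k → c * f k + d * g k) ≡ c * ∑ n f + d * ∑ n g
∑-comb n c d f g =
  trans (∑-+ n (λ k → c * f k) (λ k → d * g k)) (cong₂ _+_ (∑-* n c f) (∑-* n d g))

∑-swap : ∀ m n (f : ℕ → ℕ → ℤ) → ∑ m (λ i → ∑ n (f i)) ≡ ∑ n (λ j → ∑ m (λ i → f i j))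
∑-swap m n f = ∑-comm {m} {n} (λ i j → f (toℕ i) (toℕ j))

∑-last : ∀ n (f : ℕ → ℤ) → ∑ (suc n) f ≡ ∑ n f + f n
∑-last zero    f = trans (ℤ.+-identityʳ (f 0)) (sym (ℤ.+-identityˡ (f 0)))
∑-last (suc n) f = begin
  f 0 + ∑ (suc n) (f ∘ suc)           ≡⟨ cong (ℤ._+_ (f 0)) (∑-last n (f ∘ suc)) ⟩
  f 0 + (∑ n (f ∘ suc) + f (suc n))   ≡⟨ ℤ.+-assoc (f 0) _ _ ⟨
  ∑ (suc n) f + f (suc n)             ∎
  where open ≡-Reasoning

∑-permute : ∀ n (f : ℕ → ℤ) (σ τ : ℕ → ℕ) →
  (∀ k → k ℕ.< n → σ k ℕ.< n) → (∀ k → k ℕ.< n → τ k ℕ.< n) →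
  (∀ k → k ℕ.< n → τ (σ k) ≡ k) → (∀ k → k ℕ.< n → σ (τ k) ≡ k) →
  ∑ n (f ∘ σ) ≡ ∑ n f
∑-permute n f σ τ σ< τ< τσ στ = sym (trans
  (sum-permute (f ∘ toℕ) (permutation σ′ τ′
    (λ i → inv σ< τ< στ i)
    (λ i → inv τ< σ< τσ i)))
  (sum-cong-≗ {n} (λ i → cong f (Fin.toℕ-fromℕ< _))))
  where
  lift : {ρ : ℕ → ℕ} → (∀ k → k ℕ.< n → ρ k ℕ.< n) → Fin n → Fin n
  lift ρ< i = fromℕ< (ρ< (toℕ i) (Fin.toℕ<n i))
  σ′ = lift σ<
  τ′ = lift τ<
  inv : {ρ π : ℕ → ℕ} (ρ< : ∀ k → k ℕ.< n → ρ k ℕ.< n) (π< : ∀ k → k ℕ.< n → π k ℕ.< n) →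
        (∀ k → k ℕ.< n → ρ (π k) ≡ k) → ∀ i → lift {ρ} ρ< (lift {π} π< i) ≡ i
  inv {ρ} ρ< π< ρπ i = Fin.toℕ-injective (trans (Fin.toℕ-fromℕ< _)
    (trans (cong ρ (Fin.toℕ-fromℕ< _)) (ρπ (toℕ i) (Fin.toℕ<n i))))

∑-id : ∀ n → + 2 * ∑ n (+_) ≡ + n * (+ n - + 1)
∑-id zero    = refl
∑-id (suc n) = begin
  + 2 * ∑ (suc n) (+_)            ≡⟨ cong (+ 2 *_) (∑-last n (+_)) ⟩
  + 2 * (∑ n (+_) + + n)          ≡⟨ ℤ.*-distribˡ-+ (+ 2) (∑ n (+_)) (+ n) ⟩
  + 2 * ∑ n (+_) + + 2 * + n      ≡⟨ cong (_+ + 2 * + n) (∑-id n) ⟩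
  + n * (+ n - + 1) + + 2 * + n ≡⟨ alg (+ n) ⟩
  + suc n * (+ suc n - + 1)     ∎
  where
  open ≡-Reasoning
  alg : ∀ x → x * (x - + 1) + + 2 * x ≡ (+ 1 + x) * ((+ 1 + x) - + 1)
  alg = solve-∀

∑-sq : ∀ n → + 6 * ∑ n (λ k → + k * + k) ≡ + n * (+ n - + 1) * (+ 2 * + n - + 1)
∑-sq zero    = refl
∑-sq (suc n) = begin
  + 6 * ∑ (suc n) sq                   ≡⟨ cong (+ 6 *_) (∑-last n sq) ⟩
  + 6 * (∑ n sq + sq n)                ≡⟨ ℤ.*-distribˡ-+ (+ 6) (∑ n sq) (sq n) ⟩
  + 6 * ∑ n sq + + 6 * sq n            ≡⟨ cong (_+ + 6 * sq n) (∑-sq n) ⟩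
  + n * (+ n - + 1) * (+ 2 * + n - + 1) + + 6 * sq n ≡⟨ alg (+ n) ⟩
  + suc n * (+ suc n - + 1) * (+ 2 * + suc n - + 1)  ∎
  where
  open ≡-Reasoning
  sq : ℕ → ℤ
  sq k = + k * + k
  alg : ∀ x → x * (x - + 1) * (+ 2 * x - + 1) + + 6 * (x * x) ≡
              (+ 1 + x) * ((+ 1 + x) - + 1) * (+ 2 * (+ 1 + x) - + 1)
  alg = solve-∀

remainder-bound : ∀ {d r s q p} → r ℕ.< d → + r + q * + d ≡ + s + p * + d → p ℤ.≤ q
remainder-bound {d} {r} {s} {q} {p} r<d eq = ℤ.≮⇒≥ λ q<p → ℤ.<-irrefl refl (begin-strict
  + r + q * + d      <⟨ ℤ.+-monoˡ-< (q * + d) (ℤ.+<+ r<d) ⟩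
  + d + q * + d      ≡⟨ ℤ.suc-* q (+ d) ⟨
  ℤ.suc q * + d      ≤⟨ ℤ.*-monoʳ-≤-nonNeg (+ d) (ℤ.i<j⇒suc[i]≤j q<p) ⟩
  p * + d            ≤⟨ ℤ.i≤j+i (p * + d) (+ s) ⟩
  + s + p * + d      ≡⟨ eq ⟨
  + r + q * + d      ∎)
  where open ℤ.≤-Reasoning

divMod-unique : ∀ {d r s q p} → r ℕ.< d → s ℕ.< d →
  + r + q * + d ≡ + s + p * + d → r ≡ s × q ≡ p
divMod-unique {d} {r} {s} {q} {p} r<d s<d eq = r≡s , q≡p
  where
  q≡p = ℤ.≤-antisym (remainder-bound {q = p} {p = q} s<d (sym eq)) (remainder-bound {q = q} {p = p} r<d eq)
  r≡s = ℤ.+-injective (∙-cancelʳ (q * + d) (+ r) (+ s)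
    (trans eq (cong (λ z → + s + z * + d) (sym q≡p))))

%ℕ-unique : ∀ {d r} .{{_ : NonZero d}} i q → r ℕ.< d → i ≡ + r + q * + d → i %ℕ d ≡ r
%ℕ-unique {d} i q r<d eq =
  proj₁ (divMod-unique {q = i /ℕ d} {p = q} (n%ℕd<d i d) r<d (trans (sym (a≡a%ℕn+[a/ℕn]*n i d)) eq))

%ℕ-cong : ∀ {d} .{{_ : NonZero d}} i j q → i ≡ j + q * + d → i %ℕ d ≡ j %ℕ d
%ℕ-cong {d} i j q eq = %ℕ-unique i (j /ℕ d + q) (n%ℕd<d j d) (begin
  i                                            ≡⟨ eq ⟩
  j + q * + d                                  ≡⟨ cong (_+ q * + d) (a≡a%ℕn+[a/ℕn]*n j d) ⟩
  + (j %ℕ d) + (j /ℕ d) * + d + q * + d        ≡⟨ alg (+ (j %ℕ d)) (j /ℕ d) (+ d) q ⟩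
  + (j %ℕ d) + (j /ℕ d + q) * + d              ∎)
  where
  open ≡-Reasoning
  alg : ∀ r p d q → r + p * d + q * d ≡ r + (p + q) * d
  alg = solve-∀

-- The integer V(A,N)

-- Equational reasoning by linear combination: the difference of the goal is exhibited as a
-- combination of the differences of known equations, with explicit coefficients, so that what
-- remains is a ring identity. The versions with two to four equations peel off one equation at a
-- time.
≡-from₁ : ∀ {l₁ r₁ l r} c₁ → l₁ ≡ r₁ → l - r ≡ c₁ * (l₁ - r₁) → l ≡ r
≡-from₁ {l₁} {l = l} {r} c₁ refl eq = ℤ.i-j≡0⇒i≡j l r (trans eq (alg c₁ l₁))
  where
  alg : ∀ c x → c * (x - x) ≡ + 0
  alg = solve-∀

≡-from₂ : ∀ {l₁ r₁ l₂ r₂ l r} c₁ c₂ → l₁ ≡ r₁ → l₂ ≡ r₂ →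
  l - r ≡ c₁ * (l₁ - r₁) + c₂ * (l₂ - r₂) → l ≡ r
≡-from₂ {l₁} {l₂ = l₂} {r₂} c₁ c₂ refl eq₂ eq = ≡-from₁ c₂ eq₂ (trans eq (alg c₁ l₁ _))
  where
  alg : ∀ c x y → c * (x - x) + y ≡ y
  alg = solve-∀

≡-from₃ : ∀ {l₁ r₁ l₂ r₂ l₃ r₃ l r} c₁ c₂ c₃ → l₁ ≡ r₁ → l₂ ≡ r₂ → l₃ ≡ r₃ →
  l - r ≡ c₁ * (l₁ - r₁) + c₂ * (l₂ - r₂) + c₃ * (l₃ - r₃) → l ≡ r
≡-from₃ {l₁} c₁ c₂ c₃ refl eq₂ eq₃ eq = ≡-from₂ c₂ c₃ eq₂ eq₃ (trans eq (alg c₁ l₁ _ _))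
  where
  alg : ∀ c x y z → c * (x - x) + y + z ≡ y + z
  alg = solve-∀

≡-from₄ : ∀ {l₁ r₁ l₂ r₂ l₃ r₃ l₄ r₄ l r} c₁ c₂ c₃ c₄ →
  l₁ ≡ r₁ → l₂ ≡ r₂ → l₃ ≡ r₃ → l₄ ≡ r₄ →
  l - r ≡ c₁ * (l₁ - r₁) + c₂ * (l₂ - r₂) + c₃ * (l₃ - r₃) + c₄ * (l₄ - r₄) → l ≡ r
≡-from₄ {l₁} c₁ c₂ c₃ c₄ refl eq₂ eq₃ eq₄ eq =
  ≡-from₃ c₂ c₃ c₄ eq₂ eq₃ eq₄ (trans eq (alg c₁ l₁ _ _ _))
  where
  alg : ∀ c x y z w → c * (x - x) + y + z + w ≡ y + z + w
  alg = solve-∀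

-- Coprimality with its coefficients kept: swaps, sign changes and reductions act on them by ring
-- identities, and x is an inverse of a modulo b.
Bézout : ℤ → ℤ → Set
Bézout a b = Σ[ x ∈ ℤ ] Σ[ y ∈ ℤ ] x * a + y * b ≡ + 1

Bézout-sym : ∀ {a b} → Bézout a b → Bézout b a
Bézout-sym {a} {b} (x , y , eq) = y , x , trans (ℤ.+-comm (y * b) (x * a)) eq

Bézout-neg : ∀ {a b} → Bézout a b → Bézout (- a) b
Bézout-neg {a} {b} (x , y , eq) = - x , y , trans (alg x a y b) eq
  where
  alg : ∀ x a y b → - x * - a + y * b ≡ x * a + y * b
  alg = solve-∀

-- N·S(A,N) for A coprime to N, freed of fractions through A k = (A k mod N) + N ⌊A k / N⌋.
V : (A : ℤ) (N : ℕ) .{{_ : NonZero N}} → ℤ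
V A N = + 2 * A * (+ N - + 1) * (+ 2 * + N - + 1)
        - + 12 * ∑ N (λ k → + k * ((A * + k) /ℕ N))
        - + 3 * + N * (+ N - + 1)

module _ (A : ℤ) (N : ℕ) .{{_ : NonZero N}} where

  rem : ℕ → ℕ
  rem k = (A * + k) %ℕ N

  quo : ℕ → ℤ
  quo k = (A * + k) /ℕ N

  rem+quo : ∀ k → A * + k ≡ + rem k + quo k * + N
  rem+quo k = a≡a%ℕn+[a/ℕn]*n (A * + k) N

  rem<N : ∀ k → rem k ℕ.< N
  rem<N k = n%ℕd<d (A * + k) N

  -- Multiplying by N trades the quotients for the residues Ak mod N. In this form V visibly depends
  -- only on A modulo N, and it can be compared with the sawtooth sum.
  N*V : + N * V A N ≡ + 12 * ∑ N (λ k → + k * + rem k) - + 3 * + N * + N * (+ N - + 1)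
  N*V = ≡-from₂ (- (+ 2 * A)) (+ 12)
          (∑-sq N)
          (trans (sym (∑-* N A (λ k → + k * + k))) (trans (∑-cong N (λ k _ → pointwise k))
            (∑-comb N (+ 1) (+ N) (λ k → + k * + rem k) (λ k → + k * quo k))))
          (alg A (+ N) (∑ N (λ k → + k * + k)) (∑ N (λ k → + k * quo k)) (∑ N (λ k → + k * + rem k)))
    where
    pointwise : ∀ k → A * (+ k * + k) ≡ + 1 * (+ k * + rem k) + + N * (+ k * quo k)
    pointwise k = ≡-from₁ (+ k) (rem+quo k) (lem A (+ k) (+ rem k) (+ N) (quo k))
      where
      lem : ∀ A k r N q → A * (k * k) - (+ 1 * (k * r) + N * (k * q)) ≡ k * (A * k - (r + q * N))
      lem = solve-∀
    alg : ∀ A N K F X → N * (+ 2 * A * (N - + 1) * (+ 2 * N - + 1) - + 12 * F - + 3 * N * (N - + 1))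
        - (+ 12 * X - + 3 * N * N * (N - + 1))
        ≡ - (+ 2 * A) * (+ 6 * K - N * (N - + 1) * (+ 2 * N - + 1)) + + 12 * (A * K - (+ 1 * X + N * F))
    alg = solve-∀

nonZero-+ : ∀ N .{{_ : NonZero N}} → ℤ.NonZero (+ N)
nonZero-+ (suc N) = _

rem-shift : ∀ A N .{{_ : NonZero N}} t k → rem (A + t * + N) N k ≡ rem A N k
rem-shift A N t k = %ℕ-cong ((A + t * + N) * + k) (A * + k) (t * + k) (alg A t (+ N) (+ k))
  where
  alg : ∀ A t N k → (A + t * N) * k ≡ A * k + t * k * N
  alg = solve-∀

V-shift : ∀ A N .{{_ : NonZero N}} t → V (A + t * + N) N ≡ V A N
V-shift A N t = ℤ.*-cancelˡ-≡ (+ N) _ _ {{nonZero-+ N}} (begin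
  + N * V (A + t * + N) N   ≡⟨ N*V (A + t * + N) N ⟩
  + 12 * ∑ N (λ k → + k * + rem (A + t * + N) N k) - + 3 * + N * + N * (+ N - + 1)
    ≡⟨ cong (λ z → + 12 * z - + 3 * + N * + N * (+ N - + 1))
         (∑-cong N (λ k _ → cong (λ r → + k * + r) (rem-shift A N t k))) ⟩
  + 12 * ∑ N (λ k → + k * + rem A N k) - + 3 * + N * + N * (+ N - + 1)
    ≡⟨ N*V A N ⟨
  + N * V A N               ∎)
  where open ≡-Reasoning

-- Since k is congruent to xAk modulo N, a zero residue would make k a multiple of N, against 0 < k
-- < N.
rem≢0 : ∀ A N .{{_ : NonZero N}} → Bézout A (+ N) → ∀ k → 0 ℕ.< k → k ℕ.< N → rem A N k ≢ 0
rem≢0 A N (x , y , eq) k 0<k k<N r≡0 = ℕ.<⇒≢ 0<k (sym (proj₁ (divMod-unique {N} {q = + 0} {p = x * quo A N k + + k * y}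
  k<N (ℕ.≤-<-trans ℕ.z≤n k<N)
  (≡-from₃ (- + k) (x) (x) eq (rem+quo A N k) (cong +_ r≡0)
    (alg x y A (+ N) (+ k) (+ rem A N k) (quo A N k))))))
  where
  alg : ∀ x y A N k r q → k + + 0 * N - (+ 0 + (x * q + k * y) * N) ≡
    - k * (x * A + y * N - + 1) + x * (A * k - (r + q * N)) + x * (r - + 0)
  alg = solve-∀

-- Multiplication by A permutes the residues; multiplication by the Bézout coefficient x is the
-- inverse permutation.
∑-rem : ∀ A N .{{_ : NonZero N}} → Bézout A (+ N) → ∀ f → ∑ N (f ∘ rem A N) ≡ ∑ N f
∑-rem A N (x , y , eq) f = ∑-permute N f (rem A N) (rem x N)
  (λ k _ → rem<N A N k) (λ k _ → rem<N x N k)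
  (λ k k<N → %ℕ-unique (x * + rem A N k) (- (x * quo A N k) - + k * y) k<N
    (≡-from₂ (+ k) (- x) eq (rem+quo A N k)
      (alg x y A (+ N) (+ k) (+ rem A N k) (quo A N k))))
  (λ k k<N → %ℕ-unique (A * + rem x N k) (- (A * quo x N k) - + k * y) k<N
    (≡-from₂ (+ k) (- A) eq (rem+quo x N k)
      (alg′ x y A (+ N) (+ k) (+ rem x N k) (quo x N k))))
  where
  alg : ∀ x y A N k r q → x * r - (k + (- (x * q) - k * y) * N) ≡
    k * (x * A + y * N - + 1) + - x * (A * k - (r + q * N))
  alg = solve-∀
  alg′ : ∀ x y A N k r q → A * r - (k + (- (A * q) - k * y) * N) ≡
    k * (x * A + y * N - + 1) + - A * (x * k - (r + q * N))
  alg′ = solve-∀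

rem-neg : ∀ A N .{{_ : NonZero N}} → Bézout A (+ N) → ∀ k → 0 ℕ.< k → k ℕ.< N →
  + rem (- A) N k ≡ + N - + rem A N k
rem-neg A N bez k 0<k k<N = trans (cong +_
  (%ℕ-unique (- A * + k) (- quo A N k - + 1)
    (ℕ.∸-monoʳ-< (ℕ.n≢0⇒n>0 (rem≢0 A N bez k 0<k k<N)) (ℕ.<⇒≤ (rem<N A N k)))
    (≡-from₂ (- + 1) (- + 1) (rem+quo A N k) monus
      (alg A (+ k) (+ rem A N k) (quo A N k) (+ N) (+ (N ℕ.∸ rem A N k)))))) monus
  where
  monus : + (N ℕ.∸ rem A N k) ≡ + N - + rem A N k
  monus = trans (sym (ℤ.⊖-≥ (ℕ.<⇒≤ (rem<N A N k)))) (sym (ℤ.m-n≡m⊖n N (rem A N k)))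
  alg : ∀ A k r q N m → - A * k - (m + (- q - + 1) * N) ≡
    - + 1 * (A * k - (r + q * N)) + - + 1 * (m - (N - r))
  alg = solve-∀

-- The residues of A and -A add up to N except at k = 0, where the weight k removes the discrepancy.
-- The resulting 12N Σ k equals 6N²(N-1) and cancels the two constant terms of `N*V`.
V-neg : ∀ A N .{{_ : NonZero N}} → Bézout A (+ N) → V (- A) N ≡ - V A N
V-neg A N bez = ℤ.*-cancelˡ-≡ (+ N) _ _ {{nonZero-+ N}}
  (≡-from₄ (+ 1) (+ 1) (+ 6 * + N) (+ 12) (N*V A N) (N*V (- A) N) (∑-id N)
    (trans (∑-cong N pointwise) (∑-comb N (+ N) (- + 1) (+_) (λ k → + k * + rem A N k)))
    (alg (+ N) (V A N) (V (- A) N) (∑ N (+_)) (∑ N (λ k → + k * + rem A N k))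
         (∑ N (λ k → + k * + rem (- A) N k))))
  where
  pointwise : ∀ k → k ℕ.< N → + k * + rem (- A) N k ≡ + N * + k + - + 1 * (+ k * + rem A N k)
  pointwise zero    _   = sym (alg₀ (+ N))
    where
    alg₀ : ∀ N → N * + 0 + + 0 ≡ + 0
    alg₀ = solve-∀
  pointwise (suc k) k<N = trans (cong (+ suc k *_) (rem-neg A N bez (suc k) ℕ.z<s k<N))
    (alg₁ (+ suc k) (+ N) (+ rem A N (suc k)))
    where
    alg₁ : ∀ k N r → k * (N - r) ≡ N * k + - + 1 * (k * r)
    alg₁ = solve-∀
  alg : ∀ N v v′ K X X′ → N * v′ - N * - v ≡
    + 1 * (N * v - (+ 12 * X - + 3 * N * N * (N - + 1)))
    + + 1 * (N * v′ - (+ 12 * X′ - + 3 * N * N * (N - + 1)))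
    + + 6 * N * (+ 2 * K - N * (N - + 1))
    + + 12 * (X′ - (N * K + - + 1 * X))
  alg = solve-∀

-- Dedekind reciprocity

[_≤_] : ℕ → ℕ → ℤ
[ zero  ≤ n     ] = + 1
[ suc m ≤ zero  ] = + 0
[ suc m ≤ suc n ] = [ m ≤ n ]

[≤]-yes : ∀ {m n} → m ℕ.≤ n → [ m ≤ n ] ≡ + 1
[≤]-yes ℕ.z≤n       = refl
[≤]-yes (ℕ.s≤s m≤n) = [≤]-yes m≤n

[≤]-no : ∀ {m n} → n ℕ.< m → [ m ≤ n ] ≡ + 0
[≤]-no {suc m} {zero}  _           = refl
[≤]-no {suc m} {suc n} (ℕ.s≤s n<m) = [≤]-no n<m

∑-[≤] : ∀ n t (f : ℕ → ℤ) → t ℕ.< n → ∑ n (λ l → f l * [ l ≤ t ]) ≡ ∑ (suc t) f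
∑-[≤] (suc n) zero    f _ = cong₂ _+_ (ℤ.*-identityʳ (f 0))
  (trans (∑-cong n (λ k _ → trans (ℤ.*-zeroʳ (f (suc k))) (sym (ℤ.*-zeroʳ (+ 0)))))
         (trans (∑-* n (+ 0) (λ _ → + 0)) (ℤ.*-zeroˡ (∑ n (λ _ → + 0)))))
∑-[≤] (suc n) (suc t) f (ℕ.s≤s t<n) = cong₂ _+_ (ℤ.*-identityʳ (f 0)) (∑-[≤] n t (f ∘ suc) t<n)

∑-const : ∀ n c → ∑ n (λ _ → c) ≡ + n * c
∑-const zero    c = refl
∑-const (suc n) c = trans (cong (ℤ._+_ c) (∑-const n c)) (sym (ℤ.suc-* (+ n) c))

module _ (a b : ℕ) .{{_ : NonZero a}} .{{_ : NonZero b}} (bez : Bézout (+ a) (+ b)) where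

  private
    f g : ℕ → ℕ
    f k = (a ℕ.* k) ℕ./ b
    g l = (b ℕ.* l) ℕ./ a

    quo-f : ∀ k → quo (+ a) b k ≡ + f k
    quo-f k = cong (_/ℕ b) (sym (ℤ.pos-* a k))

    quo-g : ∀ l → quo (+ b) a l ≡ + g l
    quo-g l = cong (_/ℕ a) (sym (ℤ.pos-* b l))

    f<a : ∀ k → k ℕ.< b → f k ℕ.< a
    f<a k k<b = ℕ.m<n*o⇒m/o<n (ℕ.*-monoʳ-< a k<b)

    g<b : ∀ l → l ℕ.< a → g l ℕ.< b
    g<b l l<a = ℕ.m<n*o⇒m/o<n (ℕ.*-monoʳ-< b l<a)

    a*k≢b*l : ∀ k l → 0 ℕ.< l → l ℕ.< a → a ℕ.* k ≢ b ℕ.* l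
    a*k≢b*l k l 0<l l<a eq = rem≢0 (+ b) a (Bézout-sym bez) l 0<l l<a
      (%ℕ-unique (+ b * + l) (+ k) (ℕ.≤-<-trans ℕ.z≤n l<a) (begin
        + b * + l           ≡⟨ ℤ.pos-* b l ⟨
        + (b ℕ.* l)         ≡⟨ cong +_ eq ⟨
        + (a ℕ.* k)         ≡⟨ cong +_ (ℕ.*-comm a k) ⟩
        + (k ℕ.* a)         ≡⟨ ℤ.pos-* k a ⟩
        + k * + a           ≡⟨ ℤ.+-identityˡ (+ k * + a) ⟨
        + 0 + + k * + a     ∎))
      where open ≡-Reasoning

    -- The two indicators say bl ≤ ak and ak ≤ bl. One of these always holds, and both only on the
    -- diagonal, which has no lattice point in the rows 0 < l < a.
    below-or-above : ∀ k l → 0 ℕ.< l → l ℕ.< a → [ l ≤ f k ] + [ k ≤ g l ] ≡ + 1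
    below-or-above k l 0<l l<a with l ℕ.≤? f k
    ... | yes l≤f = cong₂ _+_ ([≤]-yes l≤f) ([≤]-no (ℕ.≰⇒> λ k≤g →
      a*k≢b*l k l 0<l l<a (ℕ.≤-antisym
        (ℕ.≤-trans (ℕ.*-monoʳ-≤ a k≤g) (subst (ℕ._≤ b ℕ.* l) (ℕ.*-comm (g l) a) (ℕ.m/n*n≤m (b ℕ.* l) a)))
        (ℕ.≤-trans (ℕ.*-monoʳ-≤ b l≤f) (subst (ℕ._≤ a ℕ.* k) (ℕ.*-comm (f k) b) (ℕ.m/n*n≤m (a ℕ.* k) b))))))
    ... | no  l≰f = cong₂ _+_ ([≤]-no (ℕ.≰⇒> l≰f)) ([≤]-yes (begin
      k                     ≡⟨ ℕ.m*n/n≡m k a ⟨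
      (k ℕ.* a) ℕ./ a       ≤⟨ ℕ./-monoˡ-≤ a k*a≤b*l ⟩
      g l                   ∎))
      where
      open ℕ.≤-Reasoning
      k*a≤b*l : k ℕ.* a ℕ.≤ b ℕ.* l
      k*a≤b*l = begin
        k ℕ.* a                          ≡⟨ ℕ.*-comm k a ⟩
        a ℕ.* k                          ≡⟨ ℕ.m≡m%n+[m/n]*n (a ℕ.* k) b ⟩
        (a ℕ.* k) ℕ.% b ℕ.+ f k ℕ.* b    ≤⟨ ℕ.+-monoˡ-≤ (f k ℕ.* b) (ℕ.<⇒≤ (ℕ.m%n<n (a ℕ.* k) b)) ⟩
        suc (f k) ℕ.* b                  ≤⟨ ℕ.*-monoˡ-≤ b (ℕ.≰⇒> l≰f) ⟩
        l ℕ.* b                          ≡⟨ ℕ.*-comm l b ⟩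
        b ℕ.* l                          ∎

    K = ∑ b (+_)
    L = ∑ a (+_)
    K₂ = ∑ b (λ k → + k * + k)
    F₀ = ∑ b (quo (+ a) b)
    F₁ = ∑ b (λ k → + k * quo (+ a) b k)
    F₂ = ∑ b (λ k → quo (+ a) b k * quo (+ a) b k)
    G₁ = ∑ a (λ l → + l * quo (+ b) a l)

    -- Twice the number of lattice points (k,l) of the rectangle, weighted by l, split along the diagonal.
    exchange : F₂ + F₀ + + 2 * (G₁ + L) ≡ + 2 * + b * L
    exchange = begin
      F₂ + F₀ + + 2 * (G₁ + L)
        ≡⟨ cong (_+ + 2 * (G₁ + L)) (trans (sym (∑-+ b (λ k → quo (+ a) b k * quo (+ a) b k) (quo (+ a) b)))
             (trans (∑-cong b (λ k k<b → below k k<b)) (∑-* b (+ 2) (λ k → ∑ a (λ l → + l * [ l ≤ f k ]))))) ⟩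
      + 2 * ∑ b (λ k → ∑ a (λ l → + l * [ l ≤ f k ])) + + 2 * (G₁ + L)
        ≡⟨ cong (λ z → + 2 * ∑ b (λ k → ∑ a (λ l → + l * [ l ≤ f k ])) + + 2 * z)
             (trans (sym (∑-+ a (λ l → + l * quo (+ b) a l) (+_)))
               (trans (∑-cong a above) (sym (∑-swap b a (λ k l → + l * [ k ≤ g l ]))))) ⟩
      + 2 * ∑ b (λ k → ∑ a (λ l → + l * [ l ≤ f k ])) + + 2 * ∑ b (λ k → ∑ a (λ l → + l * [ k ≤ g l ]))
        ≡⟨ ∑-comb b (+ 2) (+ 2) (λ k → ∑ a (λ l → + l * [ l ≤ f k ])) (λ k → ∑ a (λ l → + l * [ k ≤ g l ])) ⟨
      ∑ b (λ k → + 2 * ∑ a (λ l → + l * [ l ≤ f k ]) + + 2 * ∑ a (λ l → + l * [ k ≤ g l ]))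
        ≡⟨ ∑-cong b (λ k _ → both k) ⟩
      ∑ b (λ _ → + 2 * L)
        ≡⟨ ∑-const b (+ 2 * L) ⟩
      + b * (+ 2 * L)
        ≡⟨ alg (+ b) L ⟩
      + 2 * + b * L ∎
      where
      open ≡-Reasoning
      alg : ∀ b L → b * (+ 2 * L) ≡ + 2 * b * L
      alg = solve-∀
      below : ∀ k → k ℕ.< b → quo (+ a) b k * quo (+ a) b k + quo (+ a) b k ≡
                              + 2 * ∑ a (λ l → + l * [ l ≤ f k ])
      below k k<b = begin
        quo (+ a) b k * quo (+ a) b k + quo (+ a) b k ≡⟨ cong (λ z → z * z + z) (quo-f k) ⟩
        + f k * + f k + + f k                         ≡⟨ alg₁ (+ f k) ⟩
        + suc (f k) * (+ suc (f k) - + 1)             ≡⟨ ∑-id (suc (f k)) ⟨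
        + 2 * ∑ (suc (f k)) (+_)                      ≡⟨ cong (+ 2 *_) (∑-[≤] a (f k) (+_) (f<a k k<b)) ⟨
        + 2 * ∑ a (λ l → + l * [ l ≤ f k ])           ∎
        where
        alg₁ : ∀ x → x * x + x ≡ (+ 1 + x) * ((+ 1 + x) - + 1)
        alg₁ = solve-∀
      -- The values k = 0, ..., `g l` number `g l` + 1, which is the source of the additional L in
      -- `exchange`.
      above : ∀ l → l ℕ.< a → + l * quo (+ b) a l + + l ≡ ∑ b (λ k → + l * [ k ≤ g l ])
      above l l<a = begin
        + l * quo (+ b) a l + + l         ≡⟨ cong (λ z → + l * z + + l) (quo-g l) ⟩
        + l * + g l + + l                 ≡⟨ alg₂ (+ l) (+ g l) ⟩
        + suc (g l) * + l                 ≡⟨ ∑-const (suc (g l)) (+ l) ⟨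
        ∑ (suc (g l)) (λ _ → + l)         ≡⟨ ∑-[≤] b (g l) (λ _ → + l) (g<b l l<a) ⟨
        ∑ b (λ k → + l * [ k ≤ g l ])     ∎
        where
        alg₂ : ∀ l g → l * g + l ≡ (+ 1 + g) * l
        alg₂ = solve-∀
      both : ∀ k → + 2 * ∑ a (λ l → + l * [ l ≤ f k ]) + + 2 * ∑ a (λ l → + l * [ k ≤ g l ]) ≡ + 2 * L
      both k = begin
        + 2 * ∑ a (λ l → + l * [ l ≤ f k ]) + + 2 * ∑ a (λ l → + l * [ k ≤ g l ])
          ≡⟨ ∑-comb a (+ 2) (+ 2) (λ l → + l * [ l ≤ f k ]) (λ l → + l * [ k ≤ g l ]) ⟨
        ∑ a (λ l → + 2 * (+ l * [ l ≤ f k ]) + + 2 * (+ l * [ k ≤ g l ]))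
          ≡⟨ ∑-cong a pointwise ⟩
        ∑ a (λ l → + 2 * + l)
          ≡⟨ ∑-* a (+ 2) (+_) ⟩
        + 2 * L ∎
        where
        pointwise : ∀ l → l ℕ.< a → + 2 * (+ l * [ l ≤ f k ]) + + 2 * (+ l * [ k ≤ g l ]) ≡ + 2 * + l
        -- In the row l = 0 both indicators can be 1, but the weight l vanishes.
        pointwise zero    _   = refl
        pointwise (suc l) l<a = ≡-from₁ (+ 2 * + suc l) (below-or-above k (suc l) ℕ.z<s l<a)
          (alg₃ (+ suc l) [ suc l ≤ f k ] [ k ≤ g (suc l) ])
          where
          alg₃ : ∀ l x y → + 2 * (l * x) + + 2 * (l * y) - + 2 * l ≡ + 2 * l * (x + y - + 1)
          alg₃ = solve-∀

    -- First moment of the permuted residues ak - b⌊ak/b⌋; it determines F₀. The second moment,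
    -- below, ties F₁ to F₂.
    ∑-quo : + a * K - + b * F₀ ≡ K
    ∑-quo = trans (trans (cong (_- + b * F₀) (sym (∑-* b (+ a) (+_))))
        (trans (cong (λ z → ∑ b (λ k → + a * + k) + z) (trans (ℤ.neg-distribˡ-* (+ b) F₀) (sym (∑-* b (- + b) (quo (+ a) b)))))
        (trans (sym (∑-+ b (λ k → + a * + k) (λ k → - + b * quo (+ a) b k)))
        (∑-cong b (λ k _ → pointwise k)))))
      (∑-rem (+ a) b bez (+_))
      where
      pointwise : ∀ k → + a * + k + - + b * quo (+ a) b k ≡ + rem (+ a) b k
      pointwise k = ≡-from₁ (+ 1) (rem+quo (+ a) b k)
        (alg (+ a) (+ b) (+ k) (+ rem (+ a) b k) (quo (+ a) b k))
        where
        alg : ∀ a b k r q → a * k + - b * q - r ≡ + 1 * (a * k - (r + q * b))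
        alg = solve-∀

    ∑-quo² : + a * + a * K₂ + (- + 2 * + a * + b * F₁ + + b * + b * F₂) ≡ K₂
    ∑-quo² = begin
      + a * + a * K₂ + (- + 2 * + a * + b * F₁ + + b * + b * F₂)
        ≡⟨ cong₂ _+_ (sym (∑-* b (+ a * + a) (λ k → + k * + k)))
             (sym (∑-comb b (- + 2 * + a * + b) (+ b * + b) (λ k → + k * quo (+ a) b k)
               (λ k → quo (+ a) b k * quo (+ a) b k))) ⟩
      ∑ b (λ k → + a * + a * (+ k * + k)) +
      ∑ b (λ k → - + 2 * + a * + b * (+ k * quo (+ a) b k) + + b * + b * (quo (+ a) b k * quo (+ a) b k))
        ≡⟨ ∑-+ b (λ k → + a * + a * (+ k * + k))
             (λ k → - + 2 * + a * + b * (+ k * quo (+ a) b k) + + b * + b * (quo (+ a) b k * quo (+ a) b k)) ⟨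
      ∑ b (λ k → + a * + a * (+ k * + k) +
        (- + 2 * + a * + b * (+ k * quo (+ a) b k) + + b * + b * (quo (+ a) b k * quo (+ a) b k)))
        ≡⟨ ∑-cong b (λ k _ → pointwise k) ⟩
      ∑ b (λ k → + rem (+ a) b k * + rem (+ a) b k)
        ≡⟨ ∑-rem (+ a) b bez (λ r → + r * + r) ⟩
      K₂ ∎
      where
      open ≡-Reasoning
      pointwise : ∀ k → + a * + a * (+ k * + k) + (- + 2 * + a * + b * (+ k * quo (+ a) b k)
          + + b * + b * (quo (+ a) b k * quo (+ a) b k)) ≡ + rem (+ a) b k * + rem (+ a) b k
      pointwise k = ≡-from₁ (+ a * + k - quo (+ a) b k * + b + + rem (+ a) b k) (rem+quo (+ a) b k)
        (alg (+ a) (+ b) (+ k) (+ rem (+ a) b k) (quo (+ a) b k))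
        where
        alg : ∀ a b k r q → a * a * (k * k) + (- + 2 * a * b * (k * q) + b * b * (q * q)) - r * r ≡
          (a * k - q * b + r) * (a * k - (r + q * b))
        alg = solve-∀

  -- V(a,b) contains F₁ and V(b,a) contains G₁. The second moment relates F₁ to F₂, `exchange`
  -- relates F₂ + F₀ to G₁, and the first moment gives F₀; eliminating F₂ and F₀ links F₁ with G₁.
  -- The moments yield F₀ and F₁ only with a factor b, hence the cancellation of b.
  reciprocity : + a * V (+ a) b + + b * V (+ b) a ≡
    + a * + a + + b * + b + + 1 - + 3 * (+ a * + b)
  reciprocity = ℤ.*-cancelˡ-≡ (+ b) _ _ {{nonZero-+ b}}
    (≡-from₄ (+ 3 * + b) (- + 1) (- (+ 6 * + b * + b)) (- (+ 6 * + b * + b * (+ b - + 1)))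
      F₀-eq F-eq exchange (∑-id a) (alg (+ a) (+ b) F₀ F₁ F₂ G₁ L))
    where
    F₀-eq : + 2 * + b * F₀ ≡ + b * (+ b - + 1) * (+ a - + 1)
    F₀-eq = ≡-from₂ (- + 2) (+ a - + 1) ∑-quo (∑-id b) (lem (+ a) (+ b) F₀ K)
      where
      lem : ∀ a b F K → + 2 * b * F - b * (b - + 1) * (a - + 1) ≡
        - + 2 * (a * K - b * F - K) + (a - + 1) * (+ 2 * K - b * (b - + 1))
      lem = solve-∀
    F-eq : + 12 * + a * + b * F₁ - + 6 * + b * + b * F₂ ≡
           (+ a * + a - + 1) * (+ b * (+ b - + 1) * (+ 2 * + b - + 1))
    F-eq = ≡-from₂ (- + 6) (+ a * + a - + 1) ∑-quo² (∑-sq b) (lem (+ a) (+ b) F₁ F₂ K₂)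
      where
      lem : ∀ a b F F′ K → + 12 * a * b * F - + 6 * b * b * F′
          - (a * a - + 1) * (b * (b - + 1) * (+ 2 * b - + 1)) ≡
        - + 6 * (a * a * K + (- + 2 * a * b * F + b * b * F′) - K)
        + (a * a - + 1) * (+ 6 * K - b * (b - + 1) * (+ 2 * b - + 1))
      lem = solve-∀
    alg : ∀ a b F₀ F₁ F₂ G L →
      b * (a * (+ 2 * a * (b - + 1) * (+ 2 * b - + 1) - + 12 * F₁ - + 3 * b * (b - + 1))
           + b * (+ 2 * b * (a - + 1) * (+ 2 * a - + 1) - + 12 * G - + 3 * a * (a - + 1)))
      - b * (a * a + b * b + + 1 - + 3 * (a * b))
      ≡ + 3 * b * (+ 2 * b * F₀ - b * (b - + 1) * (a - + 1))
        + - + 1 * (+ 12 * a * b * F₁ - + 6 * b * b * F₂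
                   - (a * a - + 1) * (b * (b - + 1) * (+ 2 * b - + 1)))
        + - (+ 6 * b * b) * (F₂ + F₀ + + 2 * (G + L) - + 2 * b * L)
        + - (+ 6 * b * b * (b - + 1)) * (+ 2 * L - a * (a - + 1))
    alg = solve-∀

-- The three-term relation and positivity

0≤+ : ∀ {x y} → + 0 ℤ.≤ x → + 0 ℤ.≤ y → + 0 ℤ.≤ x + y
0≤+ = ℤ.+-mono-≤

0≤* : ∀ {x y} → + 0 ℤ.≤ x → + 0 ℤ.≤ y → + 0 ℤ.≤ x * y
0≤* {x} {y} 0≤x 0≤y = subst (ℤ._≤ x * y) (ℤ.*-zeroʳ x)
  (ℤ.*-monoˡ-≤-nonNeg x {{ℤ.nonNegative 0≤x}} 0≤y)

0<* : ∀ {x y} → + 0 ℤ.< x → + 0 ℤ.< y → + 0 ℤ.< x * y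
0<* {x} {y} 0<x 0<y = subst (ℤ._< x * y) (ℤ.*-zeroʳ x)
  (ℤ.*-monoˡ-<-pos x {{ℤ.positive 0<x}} 0<y)

0≤-cancel : ∀ x {y} → + 0 ℤ.< x → + 0 ℤ.≤ x * y → + 0 ℤ.≤ y
0≤-cancel x {y} 0<x 0≤xy = ℤ.*-cancelˡ-≤-pos (+ 0) y x {{ℤ.positive 0<x}}
  (subst (ℤ._≤ x * y) (sym (ℤ.*-zeroʳ x)) 0≤xy)

0<-cancel : ∀ x {y} → + 0 ℤ.≤ x → + 0 ℤ.< x * y → + 0 ℤ.< y
0<-cancel x {y} 0≤x 0<xy = ℤ.*-cancelˡ-<-nonNeg x {{ℤ.nonNegative 0≤x}}
  (subst (ℤ._< x * y) (sym (ℤ.*-zeroʳ x)) 0<xy)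

0≤n : ∀ {n} → + 0 ℤ.≤ + n
0≤n = ℤ.+≤+ ℕ.z≤n

0<1+n : ∀ {n} → + 0 ℤ.< + suc n
0<1+n = ℤ.+<+ ℕ.z<s

0≤n-1 : ∀ n .{{_ : NonZero n}} → + 0 ℤ.≤ + n - + 1
0≤n-1 (suc n) = 0≤n

0<n : ∀ n .{{_ : NonZero n}} → + 0 ℤ.< + n
0<n (suc n) = 0<1+n

Bézout-0⇒≡1 : ∀ {n} → Bézout (+ 0) (+ n) → n ≡ 1
Bézout-0⇒≡1 {n} (x , y , eq) = ℕ.∣1⇒≡1 (∣⇒∣ᵤ {+ n} {+ 1} (divides y (≡-from₁ (- + 1) eq (alg x y (+ n)))))
  where
  alg : ∀ x y n → + 1 - y * n ≡ - + 1 * (x * + 0 + y * n - + 1)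
  alg = solve-∀

Bézout-mod : ∀ {a r t n} → a ≡ r + t * n → Bézout a n → Bézout r n
Bézout-mod {a} {r} {t} {n} a≡ (x , y , eq) = x , x * t + y , ≡-from₂ (+ 1) (- x) eq a≡ (alg x y a r t n)
  where
  alg : ∀ x y a r t n → x * r + (x * t + y) * n - + 1 ≡
    + 1 * (x * a + y * n - + 1) + - x * (a - (r + t * n))
  alg = solve-∀

-- The extreme case is C = -1. In reciprocity for the remainder r of C the term V(D,r) enters with a
-- minus sign, so the induction hypothesis is taken at -D, which turns it into a lower bound. What
-- is left over, (D-1)(D-1-r)(r+1), is nonnegative because r < D.
V-bound : ∀ D .{{_ : NonZero D}} C → Bézout C (+ D) →
  + 0 ℤ.≤ V C D + (+ D - + 1) * (+ D - + 2)
V-bound D = go D (<-wellFounded D)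
  where
  go : ∀ D → Acc ℕ._<_ D → .{{_ : NonZero D}} → ∀ C → Bézout C (+ D) →
    + 0 ℤ.≤ V C D + (+ D - + 1) * (+ D - + 2)
  go D (acc rs) C bez with C %ℕ D | n%ℕd<d C D | a≡a%ℕn+[a/ℕn]*n C D
  ... | zero | _ | C≡ with Bézout-0⇒≡1 (Bézout-mod {t = C /ℕ D} C≡ bez)
  -- A zero remainder forces D = 1, where V and (D-1)(D-2) are both 0.
  ... | refl = ℤ.≤-reflexive (sym (trans (ℤ.+-identityʳ (V C 1))
    (trans (cong (λ z → V z 1) C≡) (V-shift (+ 0) 1 (C /ℕ 1)))))
  go D (acc rs) C bez | suc r | r<D | C≡ = subst (λ v → + 0 ℤ.≤ v + (+ D - + 1) * (+ D - + 2))
    (sym (trans (cong (λ z → V z D) C≡) (V-shift (+ suc r) D (C /ℕ D))))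
    (0≤-cancel (+ suc r) 0<1+n (subst (+ 0 ℤ.≤_) (sym step)
      (0≤+ (0≤* (0≤* (0≤n-1 D) gap) (0≤n {suc (suc r)})) (0≤* (0≤n {D}) ih))))
    where
    bez′ : Bézout (+ suc r) (+ D)
    bez′ = Bézout-mod {t = C /ℕ D} C≡ bez
    gap : + 0 ℤ.≤ + D - + 1 - + suc r
    gap = subst (+ 0 ℤ.≤_) (alg (+ D) (+ r)) (ℤ.i≤j⇒0≤j-i (ℤ.+≤+ r<D))
      where
      alg : ∀ d r → d - (+ 2 + r) ≡ d - + 1 - (+ 1 + r)
      alg = solve-∀
    ih : + 0 ℤ.≤ V (- + D) (suc r) + (+ suc r - + 1) * (+ suc r - + 2)
    ih = go (suc r) (rs r<D) (- + D) (Bézout-neg (Bézout-sym bez′))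
    step : + suc r * (V (+ suc r) D + (+ D - + 1) * (+ D - + 2)) ≡
      (+ D - + 1) * (+ D - + 1 - + suc r) * + suc (suc r) +
      + D * (V (- + D) (suc r) + (+ suc r - + 1) * (+ suc r - + 2))
    step = ≡-from₂ (+ 1) (- + D) (reciprocity (suc r) D bez′) (V-neg (+ D) (suc r) (Bézout-sym bez′))
      (alg (+ suc r) (+ D) (V (+ suc r) D) (V (+ D) (suc r)) (V (- + D) (suc r)))
      where
      alg : ∀ r D v w w′ → r * (v + (D - + 1) * (D - + 2)) -
        ((D - + 1) * (D - + 1 - r) * (+ 1 + r) + D * (w′ + (r - + 1) * (r - + 2)))
        ≡ + 1 * (r * v + D * w - (r * r + D * D + + 1 - + 3 * (r * D))) + - D * (w′ - - w)
      alg = solve-∀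

-- The determinant Q and the number R are unchanged under (A,B), (C,D) ↦ (−B,A), (−D,C).
three-term : ∀ D .{{_ : NonZero D}} C A B .{{_ : NonZero B}} Q .{{_ : NonZero Q}} →
  Bézout A (+ B) → Bézout C (+ D) → A * + D - + B * C ≡ + Q →
  Σ[ R ∈ ℤ ] Bézout R (+ Q) ×
    + D * + Q * V A B - + B * + Q * V C D - + B * + D * V R Q ≡
    + B * + B + + D * + D + + Q * + Q - + 3 * (+ B * + D * + Q)
three-term D = go D (<-wellFounded D)
  where
  go : ∀ D → Acc ℕ._<_ D → .{{_ : NonZero D}} → ∀ C A B .{{_ : NonZero B}} Q .{{_ : NonZero Q}} →
    Bézout A (+ B) → Bézout C (+ D) → A * + D - + B * C ≡ + Q →
    Σ[ R ∈ ℤ ] Bézout R (+ Q) ×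
      + D * + Q * V A B - + B * + Q * V C D - + B * + D * V R Q ≡
      + B * + B + + D * + D + + Q * + Q - + 3 * (+ B * + D * + Q)
  go D (acc rs) C A B Q bezA bezC det with C %ℕ D | n%ℕd<d C D | a≡a%ℕn+[a/ℕn]*n C D
  ... | zero | _ | C≡ with Bézout-0⇒≡1 (Bézout-mod {t = C /ℕ D} C≡ bezC)
  -- Here D = 1 and A is congruent to Q modulo B, so the relation is reciprocity for Q and B; R = -B
  -- absorbs the sign of V(B,Q).
  ... | refl = - + B , Bézout-neg (Bézout-sym bezQ) ,
    ≡-from₄ (+ 1) (+ Q) (- (+ B * + Q)) (- + B) (reciprocity Q B bezQ)
      (trans (cong (λ z → V z B) A≡) (V-shift (+ Q) B (C /ℕ 1)))
      (trans (cong (λ z → V z 1) C≡) (V-shift (+ 0) 1 (C /ℕ 1)))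
      (V-neg (+ B) Q (Bézout-sym bezQ))
      (alg (+ B) (+ Q) (V A B) (V (+ Q) B) (V (+ B) Q) (V (- + B) Q) (V C 1))
    where
    A≡ : A ≡ + Q + (C /ℕ 1) * + B
    A≡ = ≡-from₂ (+ 1) (+ B) det C≡ (lem A C (+ B) (+ Q) (C /ℕ 1))
      where
      lem : ∀ A C B Q t → A - (Q + t * B) ≡ + 1 * (A * + 1 - B * C - Q) + B * (C - (+ 0 + t * + 1))
      lem = solve-∀
    bezQ : Bézout (+ Q) (+ B)
    bezQ = Bézout-mod {t = C /ℕ 1} A≡ bezA
    alg : ∀ B Q v v′ w w′ u → + 1 * Q * v - B * Q * u - B * + 1 * w′ -
        (B * B + + 1 * + 1 + Q * Q - + 3 * (B * + 1 * Q)) ≡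
      + 1 * (Q * v′ + B * w - (Q * Q + B * B + + 1 - + 3 * (Q * B)))
      + Q * (v - v′) + - (B * Q) * (u - + 0) + - B * (w′ - - w)
    alg = solve-∀
  go D (acc rs) C A B Q bezA bezC det | suc c | c<D | C≡ =
    step (A - t * + B) refl
    where
    t = C /ℕ D
    bezc : Bézout (+ suc c) (+ D)
    bezc = Bézout-mod {t = t} C≡ bezC
    A*D : (A - t * + B) * + D ≡ + Q + + B * + suc c
    A*D = ≡-from₂ (+ 1) (+ B) det C≡ (lem A (+ D) (+ B) C (+ Q) t (+ suc c))
      where
      lem : ∀ A D B C Q t c → (A - t * B) * D - (Q + B * c) ≡
        + 1 * (A * D - B * C - Q) + B * (C - (c + t * D))
      lem = solve-∀
    -- A - tB becomes a modulus after the swap. It is positive because its product with D is Q + Bc,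
    -- c being the remainder of C.
    0<A′ : + 0 ℤ.< A - t * + B
    0<A′ = 0<-cancel (+ D) 0≤n (subst (+ 0 ℤ.<_) (trans (sym A*D) (ℤ.*-comm (A - t * + B) (+ D)))
      (ℤ.+-mono-<-≤ (0<n Q) (0≤* (0≤n {B}) (0≤n {suc c}))))
    A≡ : A ≡ A - t * + B + t * + B
    A≡ = lem A (t * + B)
      where
      lem : ∀ a b → a ≡ a - b + b
      lem = solve-∀
    step : ∀ A′ → A′ ≡ A - t * + B →
      Σ[ R ∈ ℤ ] Bézout R (+ Q) ×
        + D * + Q * V A B - + B * + Q * V C D - + B * + D * V R Q ≡
        + B * + B + + D * + D + + Q * + Q - + 3 * (+ B * + D * + Q)
    step (+ zero) eq = contradiction (subst (+ 0 ℤ.<_) (sym eq) 0<A′) (ℤ.<-irrefl refl)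
    step -[1+ _ ] eq = contradiction (subst (+ 0 ℤ.<_) (sym eq) 0<A′) λ ()
    step +[1+ a ] eq = R , bezR , trans (cong₂ (λ v w → + D * + Q * v - + B * + Q * w - + B * + D * V R Q)
        (trans (cong (λ z → V z B) A≡′) (V-shift (+ suc a) B t))
        (trans (cong (λ z → V z D) C≡) (V-shift (+ suc c) D t)))
      -- The smaller relation concerns (-B,a) and (-D,c); reciprocity for (a,B) and for (c,D)
      -- carries it back. Both introduce denominators, cleared by the factor ac, and the correction
      -- terms then agree up to a multiple of Q - (aD - Bc).
      (ℤ.*-cancelˡ-≡ (+ suc a * + suc c) _ _ {{nonZero-+ (suc a ℕ.* suc c)}}
        (≡-from₄ (+ D * + Q * + suc c) (- (+ B * + Q * + suc a)) (+ B * + D)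
          ((+ B * + D - + suc a * + suc c) * + Q - (+ suc a * + B - + suc c * + D))
          (reciprocity (suc a) B beza) (reciprocity (suc c) D bezc)
          (trans (sym (cong₂ (λ v w → + suc c * + Q * v - + suc a * + Q * w - + suc a * + suc c * V R Q)
             (V-neg (+ B) (suc a) (Bézout-sym beza)) (V-neg (+ D) (suc c) (Bézout-sym bezc)))) eqR)
          (sym det′)
          (alg (+ suc a) (+ B) (+ suc c) (+ D) (+ Q) (V (+ suc a) B) (V (+ suc c) D)
            (V (+ B) (suc a)) (V (+ D) (suc c)) (V R Q))))
      where
      A≡′ : A ≡ + suc a + t * + B
      A≡′ = trans A≡ (cong (_+ t * + B) (sym eq))
      beza : Bézout (+ suc a) (+ B)
      beza = Bézout-mod {t = t} A≡′ bezA
      det′ : + suc a * + D - + B * + suc c ≡ + Q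
      det′ = ≡-from₂ (+ 1) (+ D) A*D eq (lem (+ suc a) (A - t * + B) (+ D) (+ B) (+ suc c) (+ Q))
        where
        lem : ∀ a a′ D B c Q → a * D - B * c - Q ≡ + 1 * (a′ * D - (Q + B * c)) + D * (a - a′)
        lem = solve-∀
      ih = go (suc c) (rs c<D) (- + D) (- + B) (suc a) Q
        (Bézout-neg (Bézout-sym beza)) (Bézout-neg (Bézout-sym bezc))
        (≡-from₁ (+ 1) det′ (lem (+ suc a) (+ D) (+ B) (+ suc c) (+ Q)))
        where
        lem : ∀ a D B c Q → - B * c - a * - D - Q ≡ + 1 * (a * D - B * c - Q)
        lem = solve-∀
      R = proj₁ ih
      bezR = proj₁ (proj₂ ih)
      eqR = proj₂ (proj₂ ih)
      alg : ∀ a b c d Q v1 v2 v3 v4 v → a * c * (d * Q * v1 - b * Q * v2 - b * d * v)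
        - a * c * (b * b + d * d + Q * Q - + 3 * (b * d * Q)) ≡
        d * Q * c * ((a * v1 + b * v3) - (a * a + b * b + + 1 - + 3 * (a * b)))
        + - (b * Q * a) * ((c * v2 + d * v4) - (c * c + d * d + + 1 - + 3 * (c * d)))
        + b * d * ((c * Q * (- v3) - a * Q * (- v4) - a * c * v) - (a * a + c * c + Q * Q - + 3 * (a * c * Q)))
        + ((b * d - a * c) * Q - (a * b - c * d)) * (Q - (a * d - b * c))
      alg = solve-∀

V-positive : ∀ A B .{{_ : NonZero B}} C D .{{_ : NonZero D}} Q .{{_ : NonZero Q}} →
  Bézout A (+ B) → Bézout C (+ D) → A * + D - + B * C ≡ + Q →
  (+ Q + + D) * (+ Q + + D) * + D ℤ.≤ + B → + 0 ℤ.< V A B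
V-positive A B C D Q bezA bezC det near with three-term D C A B Q bezA bezC det
... | R , bezR , eq = 0<-cancel (+ D * + Q) (0≤* (0≤n {D}) (0≤n {Q}))
  (subst (+ 0 ℤ.<_) (sym expand)
    (ℤ.+-mono-<-≤ (0<* (0<n D) (0<n D))
      (0≤+ (0≤+ (0≤+ (0≤+
        (0≤* (0≤* (0≤n {B}) (0≤n {Q})) (V-bound D C bezC))
        (0≤* (0≤* (0≤n {B}) (0≤n {D})) (V-bound Q R bezR)))
        (0≤* (0≤n {B}) (ℤ.i≤j⇒0≤j-i near)))
        (0≤* (0≤n {Q}) (0≤n {Q})))
        (0≤* (0≤n {B}) (rest D Q)))))
  where
  -- Written in D - 1 and Q - 1, the polynomial has only nonnegative coefficients.
  rest : ∀ D Q .{{_ : NonZero D}} .{{_ : NonZero Q}} →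
    + 0 ℤ.≤ + D * + D * + Q + + D * + D * + D + + 3 * (+ D * + Q) - + 2 * + Q - + 2 * + D
  rest (suc d) (suc q) = subst (+ 0 ℤ.≤_) (alg (+ d) (+ q))
    (0≤+ (0≤+ (0≤+ (0≤* (0≤* (0≤n {suc d}) (0≤n {suc d})) (0≤n {q}))
      (0≤* (0≤n {d}) (0≤+ (0≤* (0≤n {d}) (0≤n {d})) (0≤+ (0≤* (0≤n {4}) (0≤n {d})) (0≤n {6})))))
      (0≤+ (0≤* (0≤n {3}) (0≤* (0≤n {d}) (0≤n {q}))) (0≤n {q}))) (0≤n {1}))
    where
    alg : ∀ d q → (+ 1 + d) * (+ 1 + d) * q + d * (d * d + (+ 4 * d + + 6))
        + (+ 3 * (d * q) + q) + + 1 ≡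
      (+ 1 + d) * (+ 1 + d) * (+ 1 + q) + (+ 1 + d) * (+ 1 + d) * (+ 1 + d)
      + + 3 * ((+ 1 + d) * (+ 1 + q)) - + 2 * (+ 1 + q) - + 2 * (+ 1 + d)
    alg = solve-∀
  -- B² is split into B(Q+D)²D and the surplus that `near` makes nonnegative. The first part pays
  -- for the two lower bounds and for -3BDQ, leaving the last summand; D² supplies strictness.
  expand : + D * + Q * V A B ≡ + D * + D +
    (+ B * + Q * (V C D + (+ D - + 1) * (+ D - + 2)) + + B * + D * (V R Q + (+ Q - + 1) * (+ Q - + 2))
    + + B * (+ B - (+ Q + + D) * (+ Q + + D) * + D) + + Q * + Q
    + + B * (+ D * + D * + Q + + D * + D * + D + + 3 * (+ D * + Q) - + 2 * + Q - + 2 * + D))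
  expand = ≡-from₁ (+ 1) eq (alg (+ B) (+ D) (+ Q) (V A B) (V C D) (V R Q))
    where
    alg : ∀ B D Q v u w → D * Q * v - (D * D +
      (B * Q * (u + (D - + 1) * (D - + 2)) + B * D * (w + (Q - + 1) * (Q - + 2))
      + B * (B - (Q + D) * (Q + D) * D) + Q * Q
      + B * (D * D * Q + D * D * D + + 3 * (D * Q) - + 2 * Q - + 2 * D))) ≡
      + 1 * (D * Q * v - B * Q * u - B * D * w - (B * B + D * D + Q * Q - + 3 * (B * D * Q)))
    alg = solve-∀

-- Dedekind sums as integers over N

-- Because `ℚ./` cancels common factors, the identity is checked on unnormalised fractions, where
-- equality is cross-multiplication.
/-* : ∀ p₁ n₁ .{{_ : NonZero n₁}} p₂ n₂ .{{_ : NonZero n₂}} p₃ n₃ .{{_ : NonZero n₃}} →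
  p₁ * p₂ * + n₃ ≡ p₃ * (+ n₁ * + n₂) → (p₁ ℚ./ n₁) ℚ.* (p₂ ℚ./ n₂) ≡ p₃ ℚ./ n₃
/-* p₁ (suc n₁) p₂ (suc n₂) p₃ (suc n₃) eq = ℚ.toℚᵘ-injective (begin
  toℚᵘ (fromℚᵘ x ℚ.* fromℚᵘ y)           ≈⟨ ℚ.toℚᵘ-homo-* (fromℚᵘ x) (fromℚᵘ y) ⟩
  toℚᵘ (fromℚᵘ x) ℚᵘ.* toℚᵘ (fromℚᵘ y)   ≈⟨ ℚᵘ.*-cong (ℚ.toℚᵘ-fromℚᵘ x) (ℚ.toℚᵘ-fromℚᵘ y) ⟩
  x ℚᵘ.* y                               ≈⟨ *≡* eq ⟩
  z                                      ≈⟨ ℚ.toℚᵘ-fromℚᵘ z ⟨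
  toℚᵘ (fromℚᵘ z)                        ∎)
  where
  open import Relation.Binary.Reasoning.Setoid ℚᵘ.≃-setoid
  x = mkℚᵘ p₁ n₁
  y = mkℚᵘ p₂ n₂
  z = mkℚᵘ p₃ n₃

/-+ : ∀ p₁ n₁ .{{_ : NonZero n₁}} p₂ n₂ .{{_ : NonZero n₂}} p₃ n₃ .{{_ : NonZero n₃}} →
  (p₁ * + n₂ + p₂ * + n₁) * + n₃ ≡ p₃ * (+ n₁ * + n₂) → (p₁ ℚ./ n₁) ℚ.+ (p₂ ℚ./ n₂) ≡ p₃ ℚ./ n₃
/-+ p₁ (suc n₁) p₂ (suc n₂) p₃ (suc n₃) eq = ℚ.toℚᵘ-injective (begin
  toℚᵘ (fromℚᵘ x ℚ.+ fromℚᵘ y)           ≈⟨ ℚ.toℚᵘ-homo-+ (fromℚᵘ x) (fromℚᵘ y) ⟩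
  toℚᵘ (fromℚᵘ x) ℚᵘ.+ toℚᵘ (fromℚᵘ y)   ≈⟨ ℚᵘ.+-cong (ℚ.toℚᵘ-fromℚᵘ x) (ℚ.toℚᵘ-fromℚᵘ y) ⟩
  x ℚᵘ.+ y                               ≈⟨ *≡* eq ⟩
  z                                      ≈⟨ ℚ.toℚᵘ-fromℚᵘ z ⟨
  toℚᵘ (fromℚᵘ z)                        ∎)
  where
  open import Relation.Binary.Reasoning.Setoid ℚᵘ.≃-setoid
  x = mkℚᵘ p₁ n₁
  y = mkℚᵘ p₂ n₂
  z = mkℚᵘ p₃ n₃

0</ : ∀ {p} n .{{_ : NonZero n}} → + 0 ℤ.< p → 0ℚ ℚ.< p ℚ./ n
0</ {+[1+ p ]} n _ = ℚ.positive⁻¹ _ {{ℚ.normalize-pos (suc p) n}}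
0</ {+ zero}   n 0<0 = contradiction 0<0 (ℤ.<-irrefl refl)

-- ((p/N)) = saw-num N (p mod N) / 2N
saw-num : ℕ → ℕ → ℤ
saw-num N zero    = + 0
saw-num N (suc r) = + 2 * + suc r - + N

w : ℤ → (N : ℕ) .{{_ : NonZero N}} → ℤ
w p N = saw-num N (p %ℕ N)

saw≡ : ∀ p m → saw p (suc m) ≡ w p (suc m) ℚ./ (2 ℕ.* suc m)
saw≡ p m with p %ℕ suc m
... | zero  = sym (ℚ.0/n≡0 (2 ℕ.* suc m))
... | suc r = /-+ (+ suc r) (suc m) (- + 1) 2 (+ 2 * + suc r - + suc m) (2 ℕ.* suc m)
  (trans (cong ((+ suc r * + 2 + - + 1 * + suc m) *_) (ℤ.pos-* 2 (suc m))) (alg (+ suc r) (+ suc m)))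
  where
  alg : ∀ r n → (r * + 2 + - + 1 * n) * (+ 2 * n) ≡ (+ 2 * r - n) * (n * + 2)
  alg = solve-∀

-- The index function f is arbitrary because `upTo` unfolds to `applyUpTo`, whose recursion composes
-- f with `suc`.
sumℚ-applyUpTo : ∀ (h : ℕ → ℚ) (x : ℕ → ℤ) M .{{_ : NonZero M}} →
  (∀ k → h k ≡ x k ℚ./ M) → ∀ n (f : ℕ → ℕ) →
  sumℚ (map h (map suc (applyUpTo f n))) ≡ ∑ n (x ∘ suc ∘ f) ℚ./ M
sumℚ-applyUpTo h x M h≡ zero    f = sym (ℚ.0/n≡0 M)
sumℚ-applyUpTo h x M h≡ (suc n) f = trans
  (cong₂ ℚ._+_ (h≡ (suc (f 0))) (sumℚ-applyUpTo h x M h≡ n (f ∘ suc)))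
  (/-+ (x (suc (f 0))) M (∑ n (x ∘ suc ∘ f ∘ suc)) M (∑ (suc n) (x ∘ suc ∘ f)) M
    (alg (x (suc (f 0))) (∑ n (x ∘ suc ∘ f ∘ suc)) (+ M)))
  where
  alg : ∀ x y m → (x * m + y * m) * m ≡ (x + y) * (m * m)
  alg = solve-∀

-- Each sawtooth value has denominator 2N, so S = 12 W/(4N²) = 3W/N². The range is 0 ≤ k < N in
-- place of 1 ≤ k ≤ N, which by periodicity gives the same sum.
W : ℤ → (N : ℕ) .{{_ : NonZero N}} → ℤ
W A N = ∑ N (λ k → w (+ k) N * w (A * + k) N)

w-cong : ∀ {N} .{{_ : NonZero N}} i j q → i ≡ j + q * + N → w i N ≡ w j N
w-cong {N} i j q eq = cong (saw-num N) (%ℕ-cong i j q eq)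

w-0 : ∀ N .{{_ : NonZero N}} → w (+ 0) N ≡ + 0
w-0 (suc N) = refl

-- The fraction x/M is left open because two presentations are used: V/N for coprime arguments and
-- 3W/B² for the invariance under common factors.
S≡W : ∀ A N .{{_ : NonZero N}} M .{{_ : NonZero M}} x →
  + 3 * W A N * + M ≡ x * (+ N * + N) → S A (+ N) ≡ x ℚ./ M
S≡W A N@(suc m) M x eq = trans
  (cong ((+ 12 ℚ./ 1) ℚ.*_) (sumℚ-applyUpTo _ f (4 ℕ.* (N ℕ.* N)) term N (λ k → k)))
  (/-* (+ 12) 1 (∑ N (f ∘ suc)) (4 ℕ.* (N ℕ.* N)) x M (begin
    + 12 * ∑ N (f ∘ suc) * + M       ≡⟨ cong (λ z → + 12 * z * + M) shift ⟩
    + 12 * W A N * + M               ≡⟨ ≡-from₁ (+ 4) eq (alg (W A N) (+ M) x (+ N)) ⟩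
    x * (+ 1 * (+ 4 * (+ N * + N)))  ≡⟨⟩
    x * (+ 1 * + (4 ℕ.* (N ℕ.* N)))  ∎))
  where
  open ≡-Reasoning
  f : ℕ → ℤ
  f k = w (+ k) N * w (A * + k) N
  term : ∀ k → saw (+ k) N ℚ.* saw (A * + k) N ≡ f k ℚ./ (4 ℕ.* (N ℕ.* N))
  term k = trans (cong₂ ℚ._*_ (saw≡ (+ k) m) (saw≡ (A * + k) m))
    (/-* (w (+ k) N) (2 ℕ.* N) (w (A * + k) N) (2 ℕ.* N) (f k) (4 ℕ.* (N ℕ.* N))
      (lem (w (+ k) N) (w (A * + k) N) (+ N)))
    where
    lem : ∀ x y n → x * y * (+ 4 * (n * n)) ≡ x * y * ((+ 2 * n) * (+ 2 * n))
    lem = solve-∀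
  fN≡f0 : f N ≡ f 0
  fN≡f0 = cong₂ _*_ (w-cong (+ N) (+ 0) (+ 1) (lem₁ (+ N)))
    (w-cong (A * + N) (A * + 0) A (lem₂ A (+ N)))
    where
    lem₁ : ∀ n → n ≡ + 0 + + 1 * n
    lem₁ = solve-∀
    lem₂ : ∀ a n → a * n ≡ a * + 0 + a * n
    lem₂ = solve-∀
  shift : ∑ N (f ∘ suc) ≡ W A N
  shift = ≡-from₂ (+ 1) (+ 1) (∑-last N f) fN≡f0 (lem (f 0) (∑ N (f ∘ suc)) (∑ N f) (f N))
    where
    lem : ∀ a b c d → b - c ≡ + 1 * (a + b - (c + d)) + + 1 * (d - a)
    lem = solve-∀
  alg : ∀ W M x N → + 12 * W * M - x * (+ 1 * (+ 4 * (N * N))) ≡ + 4 * (+ 3 * W * M - x * (N * N))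
  alg = solve-∀

-- For k > 0 the numerators are 2k - N and 2r - N with r = Ak mod N. In the expanded product Σ r = Σ
-- k by `∑-rem`, so only Σ kr remains, the sum occurring in `N*V`.
3W≡N*V : ∀ A N .{{_ : NonZero N}} → Bézout A (+ N) → + 3 * W A N ≡ + N * V A N
3W≡N*V A N bez = trans (cong (+ 3 *_) W≡)
  (≡-from₂ (- + 1) (- (+ 6 * + N)) (N*V A N) (∑-id N) (alg (+ N) (V A N) X (∑ N (+_))))
  where
  open ≡-Reasoning
  r = rem A N
  X = ∑ N (λ k → + k * + r k)
  alg : ∀ N v X K → + 3 * (+ 4 * X + - (+ 2 * N) * (+ 2 * K) + N * N * N - N * N) - N * v ≡
    - + 1 * (N * v - (+ 12 * X - + 3 * N * N * (N - + 1))) + - (+ 6 * N) * (+ 2 * K - N * (N - + 1))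
  alg = solve-∀
  -- The term k = 0 of W vanishes, while (2k − N)(2r − N) takes the value N² there.
  pointwise : ∀ k → k ℕ.< N → w (+ k) N * w (A * + k) N ≡
    + 1 * (+ 4 * (+ k * + r k) + - (+ 2 * + N) * (+ k + + r k)) + + 1 * (+ N * + N + - (+ N * + N) * [ k ≤ 0 ])
  pointwise zero _ = trans (cong (_* w (A * + 0) N) (w-0 N))
    (sym (trans
      (cong (λ z → + 1 * (+ 4 * (+ 0 * + z) + - (+ 2 * + N) * (+ 0 + + z)) + + 1 * (+ N * + N + - (+ N * + N) * + 1)) r0≡0)
      (lem (+ N))))
    where
    r0≡0 : r 0 ≡ 0
    r0≡0 = %ℕ-unique (A * + 0) (+ 0) (ℕ.>-nonZero⁻¹ N) (ℤ.*-zeroʳ A)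
    lem : ∀ n → + 1 * (+ 4 * (+ 0 * + 0) + - (+ 2 * n) * (+ 0 + + 0)) + + 1 * (n * n + - (n * n) * + 1) ≡ + 0
    lem = solve-∀
  pointwise (suc k) k<N = trans (cong₂ _*_
      (cong (saw-num N) (ℕ.m<n⇒m%n≡m k<N)) (nonzero (rem≢0 A N bez (suc k) ℕ.z<s k<N)))
    (lem (+ suc k) (+ r (suc k)) (+ N))
    where
    nonzero : ∀ {s} → s ≢ 0 → saw-num N s ≡ + 2 * + s - + N
    nonzero {zero}  s≢0 = contradiction refl s≢0
    nonzero {suc s} _   = refl
    lem : ∀ k r n → (+ 2 * k - n) * (+ 2 * r - n) ≡
      + 1 * (+ 4 * (k * r) + - (+ 2 * n) * (k + r)) + + 1 * (n * n + - (n * n) * + 0)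
    lem = solve-∀
  W≡ : W A N ≡ + 4 * X + - (+ 2 * + N) * (+ 2 * ∑ N (+_)) + + N * + N * + N - + N * + N
  W≡ = begin
    W A N
      ≡⟨ ∑-cong N pointwise ⟩
    ∑ N (λ k → + 1 * (+ 4 * (+ k * + r k) + - (+ 2 * + N) * (+ k + + r k)) + + 1 * (+ N * + N + - (+ N * + N) * [ k ≤ 0 ]))
      ≡⟨ ∑-comb N (+ 1) (+ 1) (λ k → + 4 * (+ k * + r k) + - (+ 2 * + N) * (+ k + + r k)) (λ k → + N * + N + - (+ N * + N) * [ k ≤ 0 ]) ⟩
    + 1 * ∑ N (λ k → + 4 * (+ k * + r k) + - (+ 2 * + N) * (+ k + + r k)) + + 1 * ∑ N (λ k → + N * + N + - (+ N * + N) * [ k ≤ 0 ])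
      ≡⟨ cong₂ (λ x y → + 1 * x + + 1 * y)
          (trans (∑-comb N (+ 4) (- (+ 2 * + N)) (λ k → + k * + r k) (λ k → + k + + r k))
            (cong (λ z → + 4 * X + - (+ 2 * + N) * z) (trans (∑-+ N (+_) (λ k → + r k)) (cong (ℤ._+_ (∑ N (+_))) (∑-rem A N bez (+_))))))
          (trans (∑-+ N (λ _ → + N * + N) (λ k → - (+ N * + N) * [ k ≤ 0 ]))
            (cong₂ _+_ (∑-const N (+ N * + N)) (∑-[≤] N 0 (λ _ → - (+ N * + N)) (ℕ.>-nonZero⁻¹ N)))) ⟩
    + 1 * (+ 4 * X + - (+ 2 * + N) * (∑ N (+_) + ∑ N (+_))) + + 1 * (+ N * (+ N * + N) + (- (+ N * + N) + + 0))
      ≡⟨ lem X (+ N) (∑ N (+_)) ⟩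
    + 4 * X + - (+ 2 * + N) * (+ 2 * ∑ N (+_)) + + N * + N * + N - + N * + N ∎
    where
    lem : ∀ X n K → + 1 * (+ 4 * X + - (+ 2 * n) * (K + K)) + + 1 * (n * (n * n) + (- (n * n) + + 0)) ≡
      + 4 * X + - (+ 2 * n) * (+ 2 * K) + n * n * n - n * n
    lem = solve-∀

S≡V/N : ∀ A N .{{_ : NonZero N}} → Bézout A (+ N) → S A (+ N) ≡ V A N ℚ./ N
S≡V/N A N bez = S≡W A N N (V A N) (trans (cong (_* + N) (3W≡N*V A N bez)) (alg (+ N) (V A N)))
  where
  alg : ∀ n v → n * v * n ≡ v * (n * n)
  alg = solve-∀

-- Invariance under common factors

∑-append : ∀ m n (f : ℕ → ℤ) → ∑ (m ℕ.+ n) f ≡ ∑ m f + ∑ n (λ k → f (m ℕ.+ k))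
∑-append zero    n f = sym (ℤ.+-identityˡ (∑ n f))
∑-append (suc m) n f = trans (cong (ℤ._+_ (f 0)) (∑-append m n (f ∘ suc)))
  (sym (ℤ.+-assoc (f 0) (∑ m (f ∘ suc)) _))

∑-blocks : ∀ m n (f : ℕ → ℤ) → ∑ (m ℕ.* n) f ≡ ∑ m (λ i → ∑ n (λ t → f (i ℕ.* n ℕ.+ t)))
∑-blocks zero    n f = refl
∑-blocks (suc m) n f = trans (∑-append n (m ℕ.* n) f) (cong (ℤ._+_ (∑ n f))
  (trans (∑-blocks m n (λ k → f (n ℕ.+ k)))
    (∑-cong m (λ i _ → ∑-cong n (λ t _ → cong f (sym (ℕ.+-assoc n (i ℕ.* n) t)))))))

module _ (A : ℤ) (B d : ℕ) .{{_ : NonZero B}} .{{_ : NonZero d}} where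

  private instance
    d*B≢0 : NonZero (d ℕ.* B)
    d*B≢0 = ℕ.m*n≢0 d B

  w-scale : ∀ p → w (p * + d) (d ℕ.* B) ≡ + d * w p B
  w-scale p = trans (cong (saw-num (d ℕ.* B)) (%ℕ-unique (p * + d) (p /ℕ B)
      (ℕ.*-monoʳ-< d (n%ℕd<d p B)) eq))
    (num d (p %ℕ B))
    where
    eq : p * + d ≡ + (d ℕ.* (p %ℕ B)) + (p /ℕ B) * + (d ℕ.* B)
    eq = ≡-from₃ (+ d) (- + 1) (- (p /ℕ B)) (a≡a%ℕn+[a/ℕn]*n p B) (ℤ.pos-* d (p %ℕ B)) (ℤ.pos-* d B)
      (alg p (+ d) (+ (p %ℕ B)) (p /ℕ B) (+ B) (+ (d ℕ.* (p %ℕ B))) (+ (d ℕ.* B)))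
      where
      alg : ∀ p d r q B x y → p * d - (x + q * y) ≡
        d * (p - (r + q * B)) + - + 1 * (x - d * r) + - q * (y - d * B)
      alg = solve-∀
    num : ∀ d .{{_ : NonZero d}} r → saw-num (d ℕ.* B) (d ℕ.* r) ≡ + d * saw-num B r
    num (suc d) zero    = trans (cong (saw-num (suc d ℕ.* B)) (ℕ.*-zeroʳ d)) (sym (ℤ.*-zeroʳ (+ suc d)))
    num (suc d) (suc r) = ≡-from₁ (- + 1) (ℤ.pos-* (suc d) B) (alg (+ suc d) (+ suc r) (+ B) (+ (suc d ℕ.* B)))
      where
      alg : ∀ d r B y → + 2 * (d * r) - y - d * (+ 2 * r - B) ≡ - + 1 * (y - d * B)
      alg = solve-∀

  -- The distribution relation of the sawtooth: the values at (t + iB)/(dB) add up to the value at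
  -- t/B. The factor d reflects the denominators 2dB and 2B. Since t > 0, no argument is an integer
  -- and each numerator is linear in i.
  ∑-w : ∀ t → 0 ℕ.< t → t ℕ.< B → ∑ d (λ i → w (+ (i ℕ.* B ℕ.+ t)) (d ℕ.* B)) ≡ + d * w (+ t) B
  ∑-w t@(suc t′) _ t<B = begin
    ∑ d (λ i → w (+ (i ℕ.* B ℕ.+ t)) (d ℕ.* B))
      ≡⟨ ∑-cong d pointwise ⟩
    ∑ d (λ i → + 2 * + B * + i + + 1 * (+ 2 * + t - + d * + B))
      ≡⟨ ∑-comb d (+ 2 * + B) (+ 1) (+_) (λ _ → + 2 * + t - + d * + B) ⟩
    + 2 * + B * ∑ d (+_) + + 1 * ∑ d (λ _ → + 2 * + t - + d * + B)
      ≡⟨ cong (λ z → + 2 * + B * ∑ d (+_) + + 1 * z) (∑-const d (+ 2 * + t - + d * + B)) ⟩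
    + 2 * + B * ∑ d (+_) + + 1 * (+ d * (+ 2 * + t - + d * + B))
      ≡⟨ ≡-from₁ (+ B) (∑-id d) (alg (+ B) (+ d) (+ t) (∑ d (+_))) ⟩
    + d * (+ 2 * + t - + B)
      ≡⟨ cong (λ r → + d * saw-num B r) (ℕ.m<n⇒m%n≡m t<B) ⟨
    + d * w (+ t) B ∎
    where
    open ≡-Reasoning
    alg : ∀ B d t D → + 2 * B * D + + 1 * (d * (+ 2 * t - d * B)) - d * (+ 2 * t - B) ≡
      B * (+ 2 * D - d * (d - + 1))
    alg = solve-∀
    pointwise : ∀ i → i ℕ.< d → w (+ (i ℕ.* B ℕ.+ t)) (d ℕ.* B) ≡
      + 2 * + B * + i + + 1 * (+ 2 * + t - + d * + B)
    pointwise i i<d = begin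
      saw-num (d ℕ.* B) ((i ℕ.* B ℕ.+ t) ℕ.% (d ℕ.* B)) ≡⟨ cong (saw-num (d ℕ.* B)) (ℕ.m<n⇒m%n≡m small) ⟩
      saw-num (d ℕ.* B) (i ℕ.* B ℕ.+ t)                 ≡⟨ cong (saw-num (d ℕ.* B)) (ℕ.+-suc (i ℕ.* B) t′) ⟩
      + 2 * + suc (i ℕ.* B ℕ.+ t′) - + (d ℕ.* B)        ≡⟨ cong (λ z → + 2 * + z - + (d ℕ.* B)) (ℕ.+-suc (i ℕ.* B) t′) ⟨
      + 2 * + (i ℕ.* B ℕ.+ t) - + (d ℕ.* B)             ≡⟨ cong₂ (λ x y → + 2 * x - y)
                                                             (trans (ℤ.pos-+ (i ℕ.* B) t) (cong (_+ + t) (ℤ.pos-* i B))) (ℤ.pos-* d B) ⟩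
      + 2 * (+ i * + B + + t) - + d * + B               ≡⟨ lem (+ i) (+ B) (+ t) (+ d) ⟩
      + 2 * + B * + i + + 1 * (+ 2 * + t - + d * + B)   ∎
      where
      lem : ∀ i B t d → + 2 * (i * B + t) - d * B ≡ + 2 * B * i + + 1 * (+ 2 * t - d * B)
      lem = solve-∀
      small : i ℕ.* B ℕ.+ t ℕ.< d ℕ.* B
      small = ℕ.<-≤-trans (ℕ.+-monoʳ-< (i ℕ.* B) t<B)
        (subst (ℕ._≤ d ℕ.* B) (ℕ.+-comm B (i ℕ.* B)) (ℕ.*-monoˡ-≤ B i<d))

  -- With k = iB + t the second sawtooth depends on t alone, so the sum over i falls on the first
  -- one, where `∑-w` applies.
  W-scale : W (A * + d) (d ℕ.* B) ≡ + d * + d * W A B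
  W-scale = begin
    W (A * + d) (d ℕ.* B)
      ≡⟨ ∑-blocks d B (λ k → w (+ k) (d ℕ.* B) * w (A * + d * + k) (d ℕ.* B)) ⟩
    ∑ d (λ i → ∑ B (λ t → w (+ (i ℕ.* B ℕ.+ t)) (d ℕ.* B) * w (A * + d * + (i ℕ.* B ℕ.+ t)) (d ℕ.* B)))
      ≡⟨ ∑-cong d (λ i _ → ∑-cong B (λ t _ → trans
           (cong (w (+ (i ℕ.* B ℕ.+ t)) (d ℕ.* B) *_) (second i t)) (ℤ.*-comm (w (+ (i ℕ.* B ℕ.+ t)) (d ℕ.* B)) (+ d * w (A * + t) B)))) ⟩
    ∑ d (λ i → ∑ B (λ t → + d * w (A * + t) B * w (+ (i ℕ.* B ℕ.+ t)) (d ℕ.* B)))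
      ≡⟨ ∑-swap d B (λ i t → + d * w (A * + t) B * w (+ (i ℕ.* B ℕ.+ t)) (d ℕ.* B)) ⟩
    ∑ B (λ t → ∑ d (λ i → + d * w (A * + t) B * w (+ (i ℕ.* B ℕ.+ t)) (d ℕ.* B)))
      ≡⟨ ∑-cong B inner ⟩
    ∑ B (λ t → + d * + d * (w (+ t) B * w (A * + t) B))
      ≡⟨ ∑-* B (+ d * + d) (λ t → w (+ t) B * w (A * + t) B) ⟩
    + d * + d * W A B ∎
    where
    open ≡-Reasoning
    second : ∀ i t → w (A * + d * + (i ℕ.* B ℕ.+ t)) (d ℕ.* B) ≡ + d * w (A * + t) B
    second i t = trans (w-cong (A * + d * + (i ℕ.* B ℕ.+ t)) (A * + t * + d) (A * + i)
        (≡-from₃ (A * + d) (A * + d) (- (A * + i)) (ℤ.pos-+ (i ℕ.* B) t) (ℤ.pos-* i B) (ℤ.pos-* d B)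
          (alg A (+ d) (+ i) (+ B) (+ t) (+ (i ℕ.* B ℕ.+ t)) (+ (i ℕ.* B)) (+ (d ℕ.* B)))))
      (w-scale (A * + t))
      where
      alg : ∀ A d i B t x y z → A * d * x - (A * t * d + A * i * z) ≡
        A * d * (x - (y + t)) + A * d * (y - i * B) + - (A * i) * (z - d * B)
      alg = solve-∀
    wA0 : w (A * + 0) B ≡ + 0
    wA0 = trans (cong (λ z → w z B) (ℤ.*-zeroʳ A)) (w-0 B)
    inner : ∀ t → t ℕ.< B → ∑ d (λ i → + d * w (A * + t) B * w (+ (i ℕ.* B ℕ.+ t)) (d ℕ.* B)) ≡
      + d * + d * (w (+ t) B * w (A * + t) B)
    -- For t = 0 the common factor `w (A * + 0) B` is 0, whatever the sum over i.
    inner zero _ = trans (∑-* d (+ d * w (A * + 0) B) (λ i → w (+ (i ℕ.* B ℕ.+ 0)) (d ℕ.* B)))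
      (≡-from₁ (+ d * ∑ d (λ i → w (+ (i ℕ.* B ℕ.+ 0)) (d ℕ.* B)) - + d * + d * w (+ 0) B) wA0
        (alg (+ d) (w (A * + 0) B) (∑ d (λ i → w (+ (i ℕ.* B ℕ.+ 0)) (d ℕ.* B))) (w (+ 0) B)))
      where
      alg : ∀ d x s v → d * x * s - d * d * (v * x) ≡ (d * s - d * d * v) * (x - + 0)
      alg = solve-∀
    inner t@(suc t′) t<B = trans (∑-* d (+ d * w (A * + t) B) (λ i → w (+ (i ℕ.* B ℕ.+ t)) (d ℕ.* B)))
      (trans (cong (+ d * w (A * + t) B *_) (∑-w t ℕ.z<s t<B)) (alg (+ d) (w (A * + t) B) (w (+ t) B)))
      where
      alg : ∀ d x v → d * x * (d * v) ≡ d * d * (v * x)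
      alg = solve-∀

  S-scale : S (A * + d) (+ (d ℕ.* B)) ≡ S A (+ B)
  S-scale = trans
    (S≡W (A * + d) (d ℕ.* B) (B ℕ.* B) {{ℕ.m*n≢0 B B}} (+ 3 * W A B) (begin
      + 3 * W (A * + d) (d ℕ.* B) * + (B ℕ.* B)     ≡⟨ cong₂ (λ x y → + 3 * x * y) W-scale (ℤ.pos-* B B) ⟩
      + 3 * (+ d * + d * W A B) * (+ B * + B)       ≡⟨ alg (+ d) (+ B) (W A B) ⟩
      + 3 * W A B * ((+ d * + B) * (+ d * + B))     ≡⟨ cong (λ z → + 3 * W A B * (z * z)) (ℤ.pos-* d B) ⟨
      + 3 * W A B * (+ (d ℕ.* B) * + (d ℕ.* B))     ∎))
    (sym (S≡W A B (B ℕ.* B) {{ℕ.m*n≢0 B B}} (+ 3 * W A B) (cong (+ 3 * W A B *_) (ℤ.pos-* B B))))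
    where
    open ≡-Reasoning
    alg : ∀ d B W → + 3 * (d * d * W) * (B * B) ≡ + 3 * W * ((d * B) * (d * B))
    alg = solve-∀

-- Reduction by the gcd

gcd-Bézout : ∀ a b → Σ[ x ∈ ℤ ] Σ[ y ∈ ℤ ] x * a + y * b ≡ gcd a b
gcd-Bézout a b with ℕ.Bézout.identity (ℕ.gcd-GCD ℤ.∣ a ∣ ℤ.∣ b ∣)
... | identity = signs (ℤ.+∣i∣≡i⊎+∣i∣≡-i a) (ℤ.+∣i∣≡i⊎+∣i∣≡-i b) (positive identity)
  where
  g = ℕ.gcd ℤ.∣ a ∣ ℤ.∣ b ∣
  ∣a∣ = ℤ.∣ a ∣
  ∣b∣ = ℤ.∣ b ∣
  cast : ∀ x m y n → g ℕ.+ x ℕ.* m ≡ y ℕ.* n → + g + + x * + m ≡ + y * + n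
  cast x m y n eq = trans (cong (ℤ._+_ (+ g)) (sym (ℤ.pos-* x m)))
    (trans (sym (ℤ.pos-+ g (x ℕ.* m))) (trans (cong +_ eq) (ℤ.pos-* y n)))
  positive : ℕ.Bézout.Identity g ∣a∣ ∣b∣ → Σ[ x ∈ ℤ ] Σ[ y ∈ ℤ ] x * + ∣a∣ + y * + ∣b∣ ≡ + g
  positive (ℕ.Bézout.+- x y eq) = + x , - + y , ≡-from₁ (- + 1) (cast y ∣b∣ x ∣a∣ eq)
    (alg (+ x) (+ y) (+ ∣a∣) (+ ∣b∣) (+ g))
    where
    alg : ∀ x y a b g → x * a + - y * b - g ≡ - + 1 * (g + y * b - x * a)
    alg = solve-∀
  positive (ℕ.Bézout.-+ x y eq) = - + x , + y , ≡-from₁ (- + 1) (cast x ∣a∣ y ∣b∣ eq)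
    (alg (+ x) (+ y) (+ ∣a∣) (+ ∣b∣) (+ g))
    where
    alg : ∀ x y a b g → - x * a + y * b - g ≡ - + 1 * (g + x * a - y * b)
    alg = solve-∀
  flip : ∀ x y → - x * y ≡ x * - y
  flip = solve-∀
  signs : ∀ {a b a′ b′ g} → a′ ≡ a ⊎ a′ ≡ - a → b′ ≡ b ⊎ b′ ≡ - b →
    Σ[ x ∈ ℤ ] Σ[ y ∈ ℤ ] x * a′ + y * b′ ≡ g → Σ[ x ∈ ℤ ] Σ[ y ∈ ℤ ] x * a + y * b ≡ g
  signs (inj₁ refl) (inj₁ refl) xy = xy
  signs {a} {b} (inj₂ refl) (inj₁ refl) (x , y , eq) =
    - x , y , trans (cong (_+ y * b) (flip x a)) eq
  signs {a} {b} (inj₁ refl) (inj₂ refl) (x , y , eq) =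
    x , - y , trans (cong (ℤ._+_ (x * a)) (flip y b)) eq
  signs {a} {b} (inj₂ refl) (inj₂ refl) (x , y , eq) =
    - x , - y , trans (cong₂ _+_ (flip x a) (flip y b)) eq

gcd≡1⇒Bézout : ∀ {a b} → gcd a b ≡ + 1 → Bézout a b
gcd≡1⇒Bézout {a} {b} gcd≡1 with gcd-Bézout a b
... | x , y , eq = x , y , trans eq gcd≡1

Bézout⇒gcd≡1 : ∀ {a b} → Bézout a b → gcd a b ≡ + 1
Bézout⇒gcd≡1 {a} {b} (x , y , eq) = cong +_ (ℕ.∣1⇒≡1 (∣⇒∣ᵤ {gcd a b} {+ 1} (subst (gcd a b ℤ.∣_) eq
  (ℤ.∣m∣n⇒∣m+n (ℤ.∣n⇒∣m*n x (∣ᵤ⇒∣ (gcd[i,j]∣i a b))) (ℤ.∣n⇒∣m*n y (∣ᵤ⇒∣ (gcd[i,j]∣j a b)))))))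

*-divz : ∀ x k .{{_ : NonZero k}} → (x * + k) divz (+ k) ≡ x
*-divz x (suc k) = trans (div-pos-is-/ℕ (x * + suc k) (suc k))
  (sym (proj₂ (divMod-unique {q = x} {p = (x * + suc k) /ℕ suc k} ℕ.z<s (n%ℕd<d (x * + suc k) (suc k))
    (trans (ℤ.+-identityˡ (x * + suc k)) (a≡a%ℕn+[a/ℕn]*n (x * + suc k) (suc k))))))

-- The gcd and the reduced pair as natural numbers and an integer, with the equations identifying
-- them with the values of `gcd` and `divz`. The arguments below use the former and pass to the
-- latter only at the end.
record Reduced (x y : ℤ) : Set where
  field
    k n′         : ℕ
    x′           : ℤ
    {{k≢0}}      : NonZero k
    {{n′≢0}}     : NonZero n′
    gcd≡         : gcd x y ≡ + k
    x≡           : x ≡ x′ * + k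
    y≡           : y ≡ + n′ * + k
    x/gcd≡       : x divz gcd x y ≡ x′
    y/gcd≡       : y divz gcd x y ≡ + n′
    bez          : Bézout x′ (+ n′)

reduce : ∀ x y → + 0 ℤ.< y → Reduced x y
reduce x (+ zero) (ℤ.+<+ ())
reduce x +[1+ n ] _ with ℕ.gcd ℤ.∣ x ∣ (suc n) in gcd≡ | gcd[i,j]∣i x +[1+ n ] | ℕ.gcd[m,n]∣n ℤ.∣ x ∣ (suc n)
... | zero  | _   | k∣n = contradiction (ℕ.0∣⇒≡0 k∣n) λ ()
... | suc k | k∣x | ℕ.divides (suc n′) n≡ with ∣ᵤ⇒∣ {+ suc k} {x} k∣x | gcd-Bézout x +[1+ n ]
... | divides x′ x≡ | u , v , eq = record
  { k = suc k ; n′ = suc n′ ; x′ = x′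
  ; gcd≡ = cong +_ gcd≡
  ; x≡ = x≡
  ; y≡ = y≡
  ; x/gcd≡ = trans (cong₂ _divz_ x≡ (cong +_ gcd≡)) (*-divz x′ (suc k))
  ; y/gcd≡ = trans (cong₂ _divz_ y≡ (cong +_ gcd≡)) (*-divz +[1+ n′ ] (suc k))
  ; bez = u , v , ℤ.*-cancelˡ-≡ (+ suc k) _ _
      (≡-from₄ (+ 1) (- u) (- v) (+ 1) eq x≡ y≡ (cong +_ gcd≡)
        (alg u v (+ suc k) x′ (+ suc n′) x (+ suc n) (gcd x +[1+ n ])))
  }
  where
  y≡ : +[1+ n ] ≡ +[1+ n′ ] * + suc k
  y≡ = trans (cong +_ n≡) (ℤ.pos-* (suc n′) (suc k))
  alg : ∀ u v k x′ n′ x y g → k * (u * x′ + v * n′) - k * + 1 ≡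
    + 1 * (u * x + v * y - g) + - u * (x - x′ * k) + - v * (y - n′ * k) + + 1 * (g - k)
  alg = solve-∀

-- Farey neighbours

≤-from-sq : ∀ {y z} → + 0 ℤ.< y → + 0 ℤ.≤ z → + 0 ℤ.≤ z * z - y * y → + 0 ℤ.≤ z - y
≤-from-sq {y} {z} 0<y 0≤z 0≤diff = 0≤-cancel (y + z) (ℤ.+-mono-<-≤ 0<y 0≤z)
  (subst (+ 0 ℤ.≤_) (alg y z) 0≤diff)
  where
  alg : ∀ y z → z * z - y * y ≡ (y + z) * (z - y)
  alg = solve-∀

-- α ≥ n^{3/2} + n, rid of its radical, says (b − n²(n−1)d³)² ≥ 4n²d³ b ≥ (2n²(q+d)d²)².
slack : ∀ b n d q → + 0 ℤ.< n → + 0 ℤ.< d → + 0 ℤ.< q →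
  + 0 ℤ.≤ b - d ℤ.^ 3 * (n ℤ.^ 3 + n ℤ.^ 2) →
  + 4 * n ℤ.^ 5 * d ℤ.^ 6 ℤ.≤ (b - d ℤ.^ 3 * (n ℤ.^ 3 + n ℤ.^ 2)) ℤ.^ 2 →
  n ℤ.^ 2 * (q + d) ℤ.^ 2 * d ℤ.≤ b →
  + 0 ℤ.≤ b - n * n * (n - + 1) * (d * d * d) - + 2 * (n * n) * (q + d) * (d * d)
slack b n d q n>0 d>0 q>0 T≥0 T² near = ≤-from-sq
  (0<* (0<* (0<* (0<n 2) (0<* n>0 n>0)) (ℤ.+-mono-< q>0 d>0)) (0<* d>0 d>0))
  -- With T = b - d³(n³ + n²), the left side of the squared inequality is T + 2n²d³; adding 2n²d³
  -- completes the square, its square being T² - 4n⁵d⁶ + 4n²d³b.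
  (subst (+ 0 ℤ.≤_) (alg₁ b n d) (0≤+ T≥0 (0≤* (0≤* (0≤n {2}) (0≤* n≥0 n≥0)) (0≤* (0≤* d≥0 d≥0) d≥0))))
  (subst (+ 0 ℤ.≤_) (alg₂ b n d q) (0≤+ (ℤ.i≤j⇒0≤j-i T²)
    (0≤* (0≤* (0≤* (0≤n {4}) (0≤* n≥0 n≥0)) (0≤* (0≤* d≥0 d≥0) d≥0)) (ℤ.i≤j⇒0≤j-i near))))
  where
  n≥0 = ℤ.<⇒≤ n>0
  d≥0 = ℤ.<⇒≤ d>0
  alg₁ : ∀ b n d → b - d * (d * (d * + 1)) * (n * (n * (n * + 1)) + n * (n * + 1)) + + 2 * (n * n) * (d * d * d) ≡
    b - n * n * (n - + 1) * (d * d * d)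
  alg₁ = solve-∀
  alg₂ : ∀ b n d q →
    (b - d * (d * (d * + 1)) * (n * (n * (n * + 1)) + n * (n * + 1))) *
    ((b - d * (d * (d * + 1)) * (n * (n * (n * + 1)) + n * (n * + 1))) * + 1)
      - + 4 * (n * (n * (n * (n * (n * + 1))))) * (d * (d * (d * (d * (d * (d * + 1))))))
    + + 4 * (n * n) * (d * d * d) * (b - n * (n * + 1) * ((q + d) * ((q + d) * + 1)) * d)
    ≡ (b - n * n * (n - + 1) * (d * d * d)) * (b - n * n * (n - + 1) * (d * d * d))
      - (+ 2 * (n * n) * (q + d) * (d * d)) * (+ 2 * (n * n) * (q + d) * (d * d))
  alg₂ = solve-∀

-- The concave quadratic in k is its value at k = 1, plus k - 1 times the chord slope bounded by
-- `slack`, plus its height (k-1)(n-k)n²d³ over the chord.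
near-scaled : ∀ b n d q k → + 0 ℤ.< n → + 0 ℤ.< d → + 0 ℤ.≤ k - + 1 → + 0 ℤ.≤ n - k →
  n ℤ.^ 2 * (q + d) ℤ.^ 2 * d ℤ.≤ b →
  + 0 ℤ.≤ b - n * n * (n - + 1) * (d * d * d) - + 2 * (n * n) * (q + d) * (d * d) →
  + 0 ℤ.≤ k * b - n * n * (q + k * d) * (q + k * d) * d
near-scaled b n d q k n>0 d>0 1≤k k≤n near sl = subst (+ 0 ℤ.≤_) (alg b n d q k)
  (0≤+ (0≤+ (ℤ.i≤j⇒0≤j-i near) (0≤* 1≤k sl))
    (0≤* (0≤* (0≤* 1≤k (0≤* n≥0 n≥0)) k≤n) (0≤* (0≤* d≥0 d≥0) d≥0)))
  where
  n≥0 = ℤ.<⇒≤ n>0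
  d≥0 = ℤ.<⇒≤ d>0
  alg : ∀ b n d q k → b - n * (n * + 1) * ((q + d) * ((q + d) * + 1)) * d
    + (k - + 1) * (b - n * n * (n - + 1) * (d * d * d) - + 2 * (n * n) * (q + d) * (d * d))
    + (k - + 1) * (n * n) * (n - k) * (d * d * d)
    ≡ k * b - n * n * (q + k * d) * (q + k * d) * d
  alg = solve-∀

-- Multiplying by k²m³ expresses everything through b, d, q and leaves r(km³b - (nq + krd)²d).
-- Replacing m³ by 1 and r inside the square by n can only lower the bracket, since m ≥ 1 and r ≤ n;
-- this gives the last assumption.
near-reduced : ∀ {b n d q k m r b′ d′ q′} →
  + 0 ℤ.< k → + 0 ℤ.< m → + 0 ℤ.≤ m - + 1 → + 0 ℤ.≤ r → + 0 ℤ.≤ n → + 0 ℤ.≤ b → + 0 ℤ.≤ d → + 0 ℤ.≤ q →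
  + 0 ℤ.≤ n - r →
  k * b′ ≡ r * b → m * d′ ≡ r * d → k * m * q′ ≡ n * q →
  + 0 ℤ.≤ k * b - n * n * (q + k * d) * (q + k * d) * d →
  (q′ + d′) ℤ.^ 2 * d′ ℤ.≤ b′
near-reduced {b} {n} {d} {q} {k} {m} {r} {b′} {d′} {q′} 0<k 0<m 1≤m 0≤r 0≤n′ 0≤b 0≤d 0≤q r≤n eb ed eq near =
  ℤ.0≤i-j⇒j≤i (0≤-cancel (k * k * (m * m * m)) (0<* (0<* 0<k 0<k) (0<* (0<* 0<m 0<m) 0<m))
    (subst (+ 0 ℤ.≤_) (sym expand) (0≤* 0≤r (0≤+ (0≤+ near
      (0≤* (0≤* (0≤* 0≤k 0≤b) 1≤m) (0≤+ (0≤+ (0≤* 0≤m 0≤m) 0≤m) (0≤n {1}))))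
      (0≤* (0≤* (0≤* 0≤d (0≤* 0≤k 0≤d)) r≤n)
        (0≤+ (0≤+ (0≤* (0≤* (0≤n {2}) 0≤n′) 0≤q) (0≤* (0≤* 0≤n′ 0≤k) 0≤d)) (0≤* (0≤* 0≤k 0≤r) 0≤d)))))))
  where
  0≤k = ℤ.<⇒≤ 0<k
  0≤m = ℤ.<⇒≤ 0<m
  open ≡-Reasoning
  alg₁ : ∀ k m b′ q′ d′ → k * k * (m * m * m) * (b′ - (q′ + d′) * ((q′ + d′) * + 1) * d′) ≡
    k * (m * m * m) * (k * b′) - (k * m * q′ + k * (m * d′)) * (k * m * q′ + k * (m * d′)) * (m * d′)
  alg₁ = solve-∀
  alg₂ : ∀ b n d q k m r →
    k * (m * m * m) * (r * b) - (n * q + k * (r * d)) * (n * q + k * (r * d)) * (r * d) ≡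
    r * (k * b - n * n * (q + k * d) * (q + k * d) * d + k * b * (m - + 1) * (m * m + m + + 1)
      + d * (k * d) * (n - r) * (+ 2 * n * q + n * k * d + k * r * d))
  alg₂ = solve-∀
  expand : k * k * (m * m * m) * (b′ - (q′ + d′) * ((q′ + d′) * + 1) * d′) ≡
    r * (k * b - n * n * (q + k * d) * (q + k * d) * d + k * b * (m - + 1) * (m * m + m + + 1)
      + d * (k * d) * (n - r) * (+ 2 * n * q + n * k * d + k * r * d))
  expand = begin
    k * k * (m * m * m) * (b′ - (q′ + d′) * ((q′ + d′) * + 1) * d′)
      ≡⟨ alg₁ k m b′ q′ d′ ⟩
    k * (m * m * m) * (k * b′) - (k * m * q′ + k * (m * d′)) * (k * m * q′ + k * (m * d′)) * (m * d′)
      ≡⟨ cong (λ z → k * (m * m * m) * z - (k * m * q′ + k * (m * d′)) * (k * m * q′ + k * (m * d′)) * (m * d′)) eb ⟩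
    k * (m * m * m) * (r * b) - (k * m * q′ + k * (m * d′)) * (k * m * q′ + k * (m * d′)) * (m * d′)
      ≡⟨ cong₂ (λ x y → k * (m * m * m) * (r * b) - (x + k * y) * (x + k * y) * y) eq ed ⟩
    k * (m * m * m) * (r * b) - (n * q + k * (r * d)) * (n * q + k * (r * d)) * (r * d)
      ≡⟨ alg₂ b n d q k m r ⟩
    _ ∎

-- The size conditions follow from the last one: for D, Q ≥ 1 the product (Q+D)²D is at least 4, and
-- it exceeds D³ by QD(Q + 2D) > 0.
isFareyNeighbour : ∀ {A C} B D Q .{{_ : NonZero D}} .{{_ : NonZero Q}} →
  Bézout A (+ B) → Bézout C (+ D) → qv A (+ B) C (+ D) ≡ + Q →
  (+ Q + + D) ℤ.^ 2 * + D ℤ.≤ + B → IsFareyNeighbour A (+ B) C (+ D)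
isFareyNeighbour {A} {C} B D Q bezA bezC q≡ near =
  ℤ.≤-trans (4≤ D Q) near , 0<n D , ℤ.<-≤-trans cube< near ,
  Bézout⇒gcd≡1 bezC , Bézout⇒gcd≡1 bezA , subst (+ 0 ℤ.≤_) (sym q≡) 0≤n ,
  subst (λ q → (q + + D) ℤ.^ 2 * + D ℤ.≤ + B) (sym q≡) near
  where
  4≤ : ∀ D Q .{{_ : NonZero D}} .{{_ : NonZero Q}} → + 4 ℤ.≤ (+ Q + + D) ℤ.^ 2 * + D
  4≤ (suc d) (suc q) = ℤ.0≤i-j⇒j≤i (subst (+ 0 ℤ.≤_) (alg (+ d) (+ q))
    (0≤+ (0≤* (0≤+ (0≤n {q}) (0≤n {d})) (0≤* (0≤+ (0≤+ (0≤n {q}) (0≤n {d})) (0≤n {4})) (0≤n {suc d})))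
      (0≤* (0≤n {4}) (0≤n {d}))))
    where
    alg : ∀ d q → (q + d) * ((q + d + + 4) * (+ 1 + d)) + + 4 * d ≡
      ((+ 1 + q) + (+ 1 + d)) * (((+ 1 + q) + (+ 1 + d)) * + 1) * (+ 1 + d) - + 4
    alg = solve-∀
  cube< : (+ D) ℤ.^ 3 ℤ.< (+ Q + + D) ℤ.^ 2 * + D
  cube< = subst (ℤ._< (+ Q + + D) ℤ.^ 2 * + D) (ℤ.+-identityʳ ((+ D) ℤ.^ 3))
    (subst ((+ D) ℤ.^ 3 + + 0 ℤ.<_) (alg (+ D) (+ Q))
      (ℤ.+-monoʳ-< ((+ D) ℤ.^ 3) (0<* (0<* (0<n Q) (0<n D)) (ℤ.+-mono-≤-< (0≤n {Q}) (0<* (0<n 2) (0<n D))))))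
    where
    alg : ∀ D Q → D * (D * (D * + 1)) + Q * D * (Q + + 2 * D) ≡ (Q + D) * ((Q + D) * + 1) * D
    alg = solve-∀

-- Expected values, and the assembly for one pair (r,j)

÷z-+ : ∀ p n .{{_ : NonZero n}} → p ÷z (+ n) ≡ p ℚ./ n
÷z-+ p (suc n) = refl

positive-ℕ : ∀ {i} → + 0 ℤ.< i → Σ[ n ∈ ℕ ] NonZero n × i ≡ + n
positive-ℕ {+ zero}   0<0 = contradiction 0<0 (ℤ.<-irrefl refl)
positive-ℕ {+[1+ n ]} _   = suc n , _ , refl

-- Substituting b′ = rb/k, d′ = rd/m and Q = nq/(km) into b′/(d′Q), both r and k cancel and m²/n
-- remains as the factor. The cross-multiplied equation is proved after multiplication by k.
E-scale : ∀ {b n d q k m r b′ d′ Q : ℕ} .{{_ : NonZero n}} .{{_ : NonZero d}} .{{_ : NonZero q}}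
  .{{_ : NonZero k}} .{{_ : NonZero d′}} .{{_ : NonZero Q}} {A C A′ C′} →
  qv A (+ b) C (+ d) ≡ + q → qv A′ (+ b′) C′ (+ d′) ≡ + Q →
  + k * + b′ ≡ + r * + b → + m * + d′ ≡ + r * + d → + k * + m * + Q ≡ + n * + q →
  E A′ (+ b′) C′ (+ d′) ≡ ((+ m * + m) ÷z (+ n)) ℚ.* E A (+ b) C (+ d)
E-scale {b} {n} {d} {q} {k} {m} {r} {b′} {d′} {Q} q≡ Q≡ eb ed eQ = begin
  (+ b′) ÷z (+ d′ * _)         ≡⟨ cong ((+ b′) ÷z_) (trans (cong (+ d′ *_) Q≡) (sym (ℤ.pos-* d′ Q))) ⟩
  (+ b′) ÷z (+ (d′ ℕ.* Q))     ≡⟨ ÷z-+ (+ b′) (d′ ℕ.* Q) ⟩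
  (+ b′ ℚ./ (d′ ℕ.* Q))
    ≡⟨ /-* (+ m * + m) n (+ b) (d ℕ.* q) (+ b′) (d′ ℕ.* Q) cross ⟨
  ((+ m * + m) ℚ./ n) ℚ.* (+ b ℚ./ (d ℕ.* q))
    ≡⟨ cong₂ ℚ._*_ (÷z-+ (+ m * + m) n) (÷z-+ (+ b) (d ℕ.* q)) ⟨
  ((+ m * + m) ÷z (+ n)) ℚ.* ((+ b) ÷z (+ (d ℕ.* q)))
    ≡⟨ cong (λ z → ((+ m * + m) ÷z (+ n)) ℚ.* ((+ b) ÷z z)) (trans (ℤ.pos-* d q) (cong (+ d *_) (sym q≡))) ⟩
  _ ∎
  where
  open ≡-Reasoning
  instance
    d′*Q≢0 : NonZero (d′ ℕ.* Q)
    d′*Q≢0 = ℕ.m*n≢0 d′ Q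
    d*q≢0 : NonZero (d ℕ.* q)
    d*q≢0 = ℕ.m*n≢0 d q
  cross : + m * + m * + b * + (d′ ℕ.* Q) ≡ + b′ * (+ n * + (d ℕ.* q))
  cross = ℤ.*-cancelˡ-≡ (+ k) _ _ {{nonZero-+ k}} (begin
    + k * (+ m * + m * + b * + (d′ ℕ.* Q))     ≡⟨ cong (λ z → + k * (+ m * + m * + b * z)) (ℤ.pos-* d′ Q) ⟩
    + k * (+ m * + m * + b * (+ d′ * + Q))     ≡⟨ alg₁ (+ k) (+ m) (+ b) (+ d′) (+ Q) ⟩
    + b * (+ m * + d′) * (+ k * + m * + Q)     ≡⟨ cong₂ (λ x y → + b * x * y) ed eQ ⟩
    + b * (+ r * + d) * (+ n * + q)            ≡⟨ alg₂ (+ r) (+ b) (+ d) (+ n) (+ q) ⟩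
    (+ r * + b) * (+ n * (+ d * + q))          ≡⟨ cong₂ (λ x y → x * (+ n * y)) eb (ℤ.pos-* d q) ⟨
    (+ k * + b′) * (+ n * + (d ℕ.* q))         ≡⟨ ℤ.*-assoc (+ k) (+ b′) _ ⟩
    + k * (+ b′ * (+ n * + (d ℕ.* q)))         ∎)
    where
    alg₁ : ∀ k m b d Q → k * (m * m * b * (d * Q)) ≡ b * (m * d) * (k * m * Q)
    alg₁ = solve-∀
    alg₂ : ∀ r b d n q → b * (r * d) * (n * q) ≡ (r * b) * (n * (d * q))
    alg₂ = solve-∀

-- The gcd m and the four quotients are variables here, so that the equations of `Reduced` can be
-- eliminated by matching on `refl`.
Conclusion : (A₀ B₀ m aʳ bʳ cʳ dʳ n a b c d : ℤ) → Set
Conclusion A₀ B₀ m aʳ bʳ cʳ dʳ n a b c d =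
  IsFareyNeighbour aʳ bʳ cʳ dʳ × S A₀ B₀ ≡ S aʳ bʳ × 0ℚ ℚ.< S aʳ bʳ ×
  E aʳ bʳ cʳ dʳ ≡ ((m * m) ÷z n) ℚ.* E a b c d

-- The assumptions on α = √(b/d³) appear without radicals. Squaring α ≥ n^{3/2} + n gives α² - n³ -
-- n² ≥ 2n^{5/2}; with T = b - d³(n³ + n²) this is T ≥ 0 together with T² ≥ 4n⁵d⁶. The bound q/d ≤
-- α/n - 1 becomes n²(q + d)²d ≤ b.
theorem1 : (b n d : ℕ) (c a : ℤ) →
    4 ℕ.≤ b → 1 ℕ.≤ n → 1 ℕ.≤ d → d ℕ.^ 3 ℕ.< b →
    + 0 ℤ.≤ c → c ℤ.< + d → gcd c (+ d) ≡ + 1 →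
    + 0 ℤ.≤ (+ b) ℤ.- (+ d) ℤ.^ 3 ℤ.* ((+ n) ℤ.^ 3 ℤ.+ (+ n) ℤ.^ 2) →
    + 4 ℤ.* (+ n) ℤ.^ 5 ℤ.* (+ d) ℤ.^ 6 ℤ.≤ ((+ b) ℤ.- (+ d) ℤ.^ 3 ℤ.* ((+ n) ℤ.^ 3 ℤ.+ (+ n) ℤ.^ 2)) ℤ.^ 2 →
    gcd a (+ b) ≡ + 1 →
    + 0 ℤ.< qv a (+ b) c (+ d) →
    (+ n) ℤ.^ 2 ℤ.* (qv a (+ b) c (+ d) ℤ.+ + d) ℤ.^ 2 ℤ.* (+ d) ℤ.≤ + b →
    (r : ℕ) .{{_ : NonZero r}} → r ∣ n → (j : ℕ) → j ℕ.< r →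
      let A₀ = (+ (n ℕ./ r)) ℤ.* a ℤ.+ (+ j) ℤ.* (+ b)
          B₀ = (+ r) ℤ.* (+ b)
          C₀ = (+ (n ℕ./ r)) ℤ.* c ℤ.+ (+ j) ℤ.* (+ d)
          D₀ = (+ r) ℤ.* (+ d)
          k = gcd A₀ B₀
          m = gcd C₀ D₀
          aʳ = A₀ divz k
          bʳ = B₀ divz k
          cʳ = C₀ divz m
          dʳ = D₀ divz m
      in IsFareyNeighbour aʳ bʳ cʳ dʳ
         × S A₀ B₀ ≡ S aʳ bʳ
         × 0ℚ ℚ.< S aʳ bʳ
         × E aʳ bʳ cʳ dʳ ≡ ((m ℤ.* m) ÷z (+ n)) ℚ.* E a (+ b) c (+ d)
theorem1 b n@(suc _) d@(suc _) c a 4≤b 1≤n 1≤d _ _ _ gcd-cd T≥0 T² gcd-ab 0<q near r r∣n j _ =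
  transport gcd≡ᵐ x/gcd≡ y/gcd≡ x/gcd≡ᵐ y/gcd≡ᵐ
    (isFareyNeighbour b′ d′ Q bez bezᵐ Q≡ near′ ,
     S-eq ,
     subst (0ℚ ℚ.<_) (sym (S≡V/N a′ b′ bez)) (0</ b′
       (V-positive a′ b′ c′ d′ Q bez bezᵐ Q≡ (subst (λ z → z * + d′ ℤ.≤ + b′) (cong ((+ Q + + d′) *_) (ℤ.*-identityʳ (+ Q + + d′))) near′))) ,
     E-scale {k = k} {m = m} {r = r} {A = a} {c} {a′} {c′} q≡ Q≡ eb ed eQ)
  where
  s = n ℕ./ r
  A₀ = + s * a + + j * + b
  B₀ = + r * + b
  C₀ = + s * c + + j * + d
  D₀ = + r * + d

  instance
    b≢0 : NonZero b
    b≢0 = ℕ.>-nonZero (ℕ.<-≤-trans ℕ.z<s 4≤b)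

  ab = reduce A₀ B₀ (0<* (0<n r) (0<n b))
  cd = reduce C₀ D₀ (0<* (0<n r) (0<n d))
  open Reduced ab renaming (n′ to b′; x′ to a′)
  open Reduced cd
    renaming (k to m; n′ to d′; x′ to c′; gcd≡ to gcd≡ᵐ; x≡ to x≡ᵐ; y≡ to y≡ᵐ;
              x/gcd≡ to x/gcd≡ᵐ; y/gcd≡ to y/gcd≡ᵐ; bez to bezᵐ; k≢0 to m≢0; n′≢0 to d′≢0)

  instance
    _ = k≢0
    _ = n′≢0
    _ = m≢0
    _ = d′≢0

  s*r≡n : + s * + r ≡ + n
  s*r≡n = trans (sym (ℤ.pos-* s r)) (cong +_ (ℕ.m/n*n≡m r∣n))

  eb : + k * + b′ ≡ + r * + b
  eb = trans (ℤ.*-comm (+ k) (+ b′)) (sym y≡)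

  ed : + m * + d′ ≡ + r * + d
  ed = trans (ℤ.*-comm (+ m) (+ d′)) (sym y≡ᵐ)

  q-nat = positive-ℕ 0<q
  q = proj₁ q-nat
  q≡ : qv a (+ b) c (+ d) ≡ + q
  q≡ = proj₂ (proj₂ q-nat)
  instance
    q≢0 : NonZero q
    q≢0 = proj₁ (proj₂ q-nat)

  det : + k * + m * qv a′ (+ b′) c′ (+ d′) ≡ + n * + q
  det = begin
    + k * + m * (a′ * + d′ - + b′ * c′)
      ≡⟨ alg₁ (+ k) (+ m) a′ (+ b′) c′ (+ d′) ⟩
    (a′ * + k) * (+ d′ * + m) - (+ b′ * + k) * (c′ * + m)
      ≡⟨ cong₂ _-_ (cong₂ _*_ x≡ y≡ᵐ) (cong₂ _*_ y≡ x≡ᵐ) ⟨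
    A₀ * D₀ - B₀ * C₀
      ≡⟨ alg₂ (+ s) (+ r) (+ j) a (+ b) c (+ d) ⟩
    + s * + r * (a * + d - + b * c)
      ≡⟨ cong₂ _*_ s*r≡n q≡ ⟩
    + n * + q ∎
    where
    open ≡-Reasoning
    alg₁ : ∀ k m a b c d → k * m * (a * d - b * c) ≡ (a * k) * (d * m) - (b * k) * (c * m)
    alg₁ = solve-∀
    alg₂ : ∀ s r j a b c d → (s * a + j * b) * (r * d) - (r * b) * (s * c + j * d) ≡ s * r * (a * d - b * c)
    alg₂ = solve-∀

  Q-nat = positive-ℕ (0<-cancel (+ k * + m) (0≤* (0≤n {k}) (0≤n {m}))
    (subst (+ 0 ℤ.<_) (sym det) (0<* (0<n n) (0<n q))))
  Q = proj₁ Q-nat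
  Q≡ : qv a′ (+ b′) c′ (+ d′) ≡ + Q
  Q≡ = proj₂ (proj₂ Q-nat)
  instance
    Q≢0 : NonZero Q
    Q≢0 = proj₁ (proj₂ Q-nat)

  eQ : + k * + m * + Q ≡ + n * + q
  eQ = trans (cong (+ k * + m *_) (sym Q≡)) det

  -- na = rA₀ − jB₀ and nb = (n/r)B₀, while (a,b) is primitive.
  k∣n : k ∣ n
  k∣n with gcd≡1⇒Bézout {a} {+ b} gcd-ab
  ... | x , y , eq = ∣⇒∣ᵤ {+ k} {+ n} (divides (x * (+ r * a′ - + j * + b′) + y * (+ s * + b′))
    (≡-from₄ (- + n) (+ 1) (x * + r) (- (x * + j) + y * + s) eq (s*r≡n′ x y) x≡ y≡
      (alg x y a (+ b) (+ n) (+ s) (+ r) (+ j) a′ (+ b′) (+ k))))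
    where
    s*r≡n′ : ∀ x y → (x * a + y * + b) * (+ n) ≡ (x * a + y * + b) * (+ s * + r)
    s*r≡n′ x y = cong ((x * a + y * + b) *_) (sym s*r≡n)
    alg : ∀ x y a b n s r j a′ b′ k → n - (x * (r * a′ - j * b′) + y * (s * b′)) * k ≡
      - n * (x * a + y * b - + 1) + + 1 * ((x * a + y * b) * n - (x * a + y * b) * (s * r))
      + x * r * (s * a + j * b - a′ * k) + (- (x * j) + y * s) * (r * b - b′ * k)
    alg = solve-∀

  near-q : (+ n) ℤ.^ 2 * (+ q + + d) ℤ.^ 2 * + d ℤ.≤ + b
  near-q = subst (λ z → (+ n) ℤ.^ 2 * (z + + d) ℤ.^ 2 * + d ℤ.≤ + b) q≡ near

  near′ : (+ Q + + d′) ℤ.^ 2 * + d′ ℤ.≤ + b′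
  near′ = near-reduced {+ b} {+ n} {+ d} {+ q} {+ k} {+ m} {+ r} {+ b′} {+ d′} {+ Q}
    (0<n k) (0<n m) (0≤n-1 m) (0≤n {r}) (0≤n {n}) (0≤n {b}) (0≤n {d}) (0≤n {q})
    (ℤ.i≤j⇒0≤j-i (ℤ.+≤+ (ℕ.∣⇒≤ r∣n))) eb ed eQ
    (near-scaled (+ b) (+ n) (+ d) (+ q) (+ k) (0<n n) (0<n d) (0≤n-1 k)
      (ℤ.i≤j⇒0≤j-i (ℤ.+≤+ (ℕ.∣⇒≤ k∣n))) near-q
      (slack (+ b) (+ n) (+ d) (+ q) (0<n n) (0<n d) (0<n q) T≥0 T² near-q))

  S-eq : S A₀ B₀ ≡ S a′ (+ b′)
  S-eq = trans (cong₂ S x≡ (trans (sym eb) (sym (ℤ.pos-* k b′)))) (S-scale a′ b′ k)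

  transport : ∀ {m₁ a₁ b₁ c₁ d₁} → m₁ ≡ + m → a₁ ≡ a′ → b₁ ≡ + b′ → c₁ ≡ c′ → d₁ ≡ + d′ →
    Conclusion A₀ B₀ (+ m) a′ (+ b′) c′ (+ d′) (+ n) a (+ b) c (+ d) →
    Conclusion A₀ B₀ m₁ a₁ b₁ c₁ d₁ (+ n) a (+ b) c (+ d)
  transport refl refl refl refl refl x = x
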